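{- Let $1\le i<j\le m$. For all sufficiently large positive integers $q$, the number $|M((\mathcal{B}_m^{\{x_i-x_j=0\}})_q)|$ of points $(x_1,\dots,x_m)\in\mathbb{Z}_q^m$ with $x_i=x_j$ that lie on no hyperplane $H'_q$ with $H'\in\mathcal{B}_m\setminus\{\{x_i-x_j=0\}\}$ equals $$\begin{cases}(q-2m+1)^{j-i-1}(q-2m+2)^{m-j}\big((q-2m+2)^i-(q-2m+1)^{i-1}\big) & \text{if } q \text{ is odd},\\ (q-2m+1)^{j-i-1}(q-2m+2)^{i-1}\big((q-2m+2)^{m-j+1}-(q-2m+1)^{m-j}\big) & \text{if } q \text{ is even}.\end{cases}$$
   Context: For $m\ge1$, the Shi arrangement of type B is the set of affine hyperplanes in $\mathbb{R}^m$ $$\mathcal{B}_m=\{\{x_s=0\},\{x_s=1\}\mid s\in[m]\}\cup\{\{x_s\pm x_t=0\},\{x_s\pm x_t=1\}\mid 1\le s<t\le m\},$$ where $[m]=\{1,\dots,m\}$. For a positive integer $q$ and a hyperplane $H=\{a_1x_1+\dots+a_mx_m=b\}$ with integer coefficients, $H_q=\{x\in\mathbb{Z}_q^m : [a_1]_qx_1+\dots+[a_m]_qx_m=[b]_q\}$ is its reduction modulo $q$, with $\mathbb{Z}_q=\mathbb{Z}/q\mathbb{Z}$. For $H\in\mathcal{B}_m$, the restriction is $\mathcal{B}_m^H=\{H\cap H' : H'\in\mathcal{B}_m\setminus\{H\},\ H\cap H'\neq\emptyset\}$, and $|M((\mathcal{B}_m^H)_q)|$ denotes the number of points of $H_q$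 not lying on any $H'_q$ with $H'\in\mathcal{B}_m\setminus\{H\}$ (the characteristic quasi-polynomial of the restriction). -}

module Defs where

open import Data.Nat as ℕ using (ℕ; zero; suc; _<_)
open import Data.Nat.Divisibility as ℕD using (_∣?_)
open import Data.Integer as ℤ using (ℤ; +_; ∣_∣)
open import Data.Fin using (Fin; toℕ; _≟_)
open import Data.Fin.Properties as FinP using (_<?_)
open import Data.Vec using (Vec; []; _∷_; tabulate; zipWith; foldr; lookup)
open import Data.List as L using (List; []; _∷_; [_]; concatMap; upTo; allFin; filter; length; _++_)
open import Data.List.Relation.Unary.All as All using (All)
open import Data.Product using (_×_; _,_; proj₁; proj₂)
open import Relation.Nullary using (Dec; yes; no; ¬_)
open import Relation.Nullary.Decidable using (_×-dec_; ¬?)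
open import Relation.Binary.PropositionalEquality using (_≡_)

-- An affine hyperplane {a₁x₁+…+aₘxₘ = b} with integer coefficients,
-- represented by its coefficient vector a and right-hand side b.
Hyp : ℕ → Set
Hyp m = Vec ℤ m × ℤ

e : {m : ℕ} → Fin m → Vec ℤ m
e s = tabulate (λ k → if-eq k)
  where
  if-eq : _ → ℤ
  if-eq k with k ≟ s
  ... | yes _ = + 1
  ... | no  _ = + 0

_⊕_ _⊖_ : {m : ℕ} → Vec ℤ m → Vec ℤ m → Vec ℤ m
u ⊕ v = zipWith ℤ._+_ u v
u ⊖ v = zipWith ℤ._-_ u v

shiB : (m : ℕ) → List (Hyp m)
shiB m =
  concatMap (λ s → (e s , + 0) ∷ (e s , + 1) ∷ []) (allFin m)
  ++ concatMap (λ s → concatMap (λ t → pairs s t)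
                         (filter (λ t → s <? t) (allFin m)))
               (allFin m)
  where
  pairs : Fin m → Fin m → List (Hyp m)
  pairs s t = (e s ⊕ e t , + 0) ∷ (e s ⊕ e t , + 1)
            ∷ (e s ⊖ e t , + 0) ∷ (e s ⊖ e t , + 1) ∷ []

-- All points of ℤ_q^m, elements of ℤ_q represented by 0,…,q-1.
points : (q m : ℕ) → List (Vec ℕ m)
points q zero    = [ [] ]
points q (suc m) = concatMap (λ x → L.map (x ∷_) (points q m)) (upTo q)

dot : {m : ℕ} → Vec ℤ m → Vec ℕ m → ℤ
dot a x = foldr (λ _ → ℤ) ℤ._+_ (+ 0) (zipWith (λ c y → c ℤ.* (+ y)) a x)

-- x ∈ H_q  :⇔  [a₁]x₁+…+[aₘ]xₘ = [b] in ℤ_q  ⇔  q ∣ (a·x − b)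
_∈[_]_ : {m : ℕ} → Vec ℕ m → ℕ → Hyp m → Set
x ∈[ q ] (a , b) = q ℕD.∣ ∣ dot a x ℤ.- b ∣

_∈[_]?_ : {m : ℕ} → (x : Vec ℕ m) → (q : ℕ) → (H : Hyp m) → Dec (x ∈[ q ] H)
x ∈[ q ]? (a , b) = q ∣? ∣ dot a x ℤ.- b ∣

-- B_m ∖ {H}: remove H from the list (hyperplanes of B_m are pairwise distinct
-- as coefficient data, so this removes exactly the hyperplane H).
_≟H_ : {m : ℕ} → (H K : Hyp m) → Dec (H ≡ K)
_≟H_ {m} (a , b) (c , d) = Data.Product.Properties.≡-dec
    (Data.Vec.Properties.≡-dec ℤ._≟_) ℤ._≟_ (a , b) (c , d)
  where import Data.Product.Properties
        import Data.Vec.Properties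

removeH : {m : ℕ} → Hyp m → List (Hyp m) → List (Hyp m)
removeH H = filter (λ K → ¬? (H ≟H K))

countM : (m q : ℕ) → Hyp m → ℕ
countM m q H = length (filter (λ x → (x ∈[ q ]? H) ×-dec
                                      All.all? (λ K → ¬? (x ∈[ q ]? K)) (removeH H (shiB m)))
                              (points q m))

-- Put b = q − 2m + 2 and identify the labels i and j.  Lay out ℤ_q as 0, …, q − 1, with every label s at
-- x_s and its negative at −x_s.  Counting the empty residues below x_s (corrected by one beyond the middle
-- q/2) gives y_s + 2 with 0 ≤ y_s < b.  Inside a run of occupied residues the inequalities x_s ≠ x_t + 1 for
-- s < t and x_s + x_t ≠ 1 force the order of the labels, so x can be recovered from y as
-- x_s = y_s + Σ_u K u s, where K u s counts which of ±u lie below s and depends on y only through the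
-- lexicographic order of (y_u , u) and (y_s , s) and the sign of y_u + y_s + 2 − b.  The y that occur are
-- exactly those with y_j = y_i and y_t ≠ y_i for i < t < j, which are b · b^(i−1) (b−1)^(j−i−1) b^(m−j) many.
-- The remaining condition 2x_i ∉ {0, 1} excludes the y for which y_i is the middle value and no u < i
-- (q odd), respectively no u > j (q even), has the same value; subtracting their number gives the formula.

module Submission where

open import Defs
open import Data.Nat as ℕ hiding (_≟_)
open import Data.Nat.Properties hiding (_≟_)
open import Data.Nat.Divisibility as ℕD using (_∣_)
open import Data.Nat.DivMod using (m≡m%n+[m/n]*n; m*n%n≡0; [m+kn]%n≡m%n)
open import Data.Nat.Tactic.RingSolver using (solve-∀)
open import Data.Integer as ℤ using (ℤ; +_; ∣_∣)
import Data.Integer.Properties as ℤP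
open import Data.Fin using (Fin; zero; suc; toℕ; _≟_)
import Data.Fin.Properties as FinP
open import Data.Bool using (if_then_else_)
open import Data.List using (List; []; _∷_; [_]; _++_; map; concatMap; filter; allFin; upTo; length)
open import Data.List.Properties using (length-map; length-++; length-upTo)
open import Data.List.Membership.Propositional using (_∈_; find; lose)
open import Data.List.Membership.Propositional.Properties
open import Data.List.Membership.Propositional.Properties.WithK using (unique∧set⇒bag)
open import Data.List.Relation.Binary.BagAndSetEquality using (∼bag⇒↭)
open import Data.List.Relation.Binary.Permutation.Propositional.Properties using (↭-length)
open import Data.List.Relation.Unary.Any using (here; there)
open import Data.List.Relation.Unary.All as All using (All; []; _∷_)
import Data.List.Relation.Unary.All.Properties as AllP
open import Data.List.Relation.Unary.AllPairs using ([]; _∷_)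
open import Data.List.Relation.Unary.Unique.Propositional using (Unique)
import Data.List.Relation.Unary.Unique.Propositional.Properties as Uniq
open import Data.Vec using (Vec; []; _∷_; lookup; tabulate)
import Data.Vec.Properties as VecP
open import Data.Product using (_×_; _,_; ∃-syntax; proj₁; proj₂)
open import Data.Sum using (_⊎_; inj₁; inj₂; [_,_]′)
open import Data.Empty using (⊥; ⊥-elim)
open import Function using (_∘_; id; _∋_; mk⇔)
open import Relation.Nullary
open import Relation.Nullary.Decidable using (_×-dec_; _⊎-dec_; ¬?; dec-true; dec-false)
open import Relation.Binary.Definitions using (tri<; tri≈; tri>)
open import Relation.Binary.PropositionalEquality hiding ([_])
open import Algebra.Properties.CommutativeMonoid.Sum +-0-commutativeMonoid
  using (sum; sum-cong-≗; ∑-distrib-+)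
open import Algebra.Properties.CommutativeSemigroup ℤP.+-commutativeSemigroup using (interchange)

-- The number `b` is what remains of the `q` residues when each of the `m - 1` different labels
-- takes two of them, one for itself and one for its negative. The obstacle is the middle of the
-- cycle. The arrangement contains neither 2x_s = 0 nor 2x_s = 1, so a label may coincide with its
-- negative or sit directly above it; only x_i = x_j turns the hyperplanes of x_i + x_j into such
-- conditions, and only for one label. Dropping them at first treats all labels alike and makes the
-- count a plain product; this is why the formula is a difference. Neither direction of the
-- bijection sorts the labels or inducts on their number. The summands of `ΣK` are pairwise
-- comparisons that can be read off `y` as well as off `x`. Once both readings are known to agree,
-- the two sums are equal and cancel.

-- Linear arithmetic: L ≤ R is a sum of hypotheses and the ring solver supplies the balance.
balance-≤ : ∀ {A B L R} → L ≤ R → A + R ≡ B + L → A ≤ B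
balance-≤ {A} {B} {L} {R} h eq = +-cancelʳ-≤ R A B (≤-trans (≤-reflexive eq) (+-monoʳ-≤ B h))

balance-≡ : ∀ {A B L R} → L ≡ R → A + R ≡ B + L → A ≡ B
balance-≡ {A} {B} {L} refl eq = +-cancelʳ-≡ L A B eq

*2≡+ : ∀ v → v * 2 ≡ v + v
*2≡+ = solve-∀

double-injective : ∀ {v w} → v + v ≡ w + w → v ≡ w
double-injective {v} {w} e = *-cancelʳ-≡ v w 2 (trans (*2≡+ v) (trans e (sym (*2≡+ w))))

-- Indicators of decidable propositions and finite sums

ind : ∀ {p} {P : Set p} → Dec P → ℕ
ind d = if does d then 1 else 0

module _ {p} {P : Set p} where

  ind-yes : (d : Dec P) → P → ind d ≡ 1
  ind-yes d x rewrite dec-true d x = refl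

  ind-no : (d : Dec P) → ¬ P → ind d ≡ 0
  ind-no d x rewrite dec-false d x = refl

  ind≤1 : (d : Dec P) → ind d ≤ 1
  ind≤1 (yes _) = ≤-refl
  ind≤1 (no _)  = z≤n

module _ {p q} {P : Set p} {Q : Set q} where

  ind-mono : (d : Dec P) (d′ : Dec Q) → (P → Q) → ind d ≤ ind d′
  ind-mono (yes x) d′ f rewrite ind-yes d′ (f x) = ≤-refl
  ind-mono (no _)  d′ f = z≤n

  ind-exclusive : (d : Dec P) (d′ : Dec Q) → (P → ¬ Q) → ind d + ind d′ ≤ 1
  ind-exclusive (yes x) d′ f rewrite ind-no d′ (f x) = ≤-refl
  ind-exclusive (no _)  d′ f = ind≤1 d′

  ind-exhaustive : (d : Dec P) (d′ : Dec Q) → (¬ P → Q) → 1 ≤ ind d + ind d′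
  ind-exhaustive (yes _) d′ f = s≤s z≤n
  ind-exhaustive (no x)  d′ f rewrite ind-yes d′ (f x) = ≤-refl

ind-cong : ∀ {p q} {P : Set p} {Q : Set q} (d : Dec P) (d′ : Dec Q) → (P → Q) → (Q → P) → ind d ≡ ind d′
ind-cong d d′ f g = ≤-antisym (ind-mono d d′ f) (ind-mono d′ d g)

ind-<-suc : ∀ a v → ind (a <? suc v) ≡ ind (a <? v) + ind (a ℕ.≟ v)
ind-<-suc a v with <-cmp a v
... | tri< a<v a≢v _ rewrite ind-yes (a <? suc v) (m<n⇒m<1+n a<v) | ind-yes (a <? v) a<v | ind-no (a ℕ.≟ v) a≢v
    = refl
... | tri≈ a≮v refl _ rewrite ind-yes (a <? suc a) ≤-refl | ind-no (a <? a) a≮v | ind-yes (a ℕ.≟ a) refl = refl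
... | tri> a≮v a≢v v<a rewrite ind-no (a <? suc v) (≤⇒≯ v<a) | ind-no (a <? v) a≮v | ind-no (a ℕ.≟ v) a≢v = refl

sum-const : ∀ m c → sum {m} (λ _ → c) ≡ m * c
sum-const zero    c = refl
sum-const (suc m) c = cong (λ z → c + z) (sum-const m c)

sum-mono : ∀ {m} {f g : Fin m → ℕ} → (∀ u → f u ≤ g u) → sum f ≤ sum g
sum-mono {zero}  h = z≤n
sum-mono {suc m} h = +-mono-≤ (h zero) (sum-mono (h ∘ suc))

sum-mono-< : ∀ {m} {f g : Fin m → ℕ} → (∀ u → f u ≤ g u) → ∀ w → f w < g w → sum f < sum g
sum-mono-< {suc m} h zero    l = +-mono-<-≤ l (sum-mono (h ∘ suc))
sum-mono-< {suc m} h (suc w) l = +-mono-≤-< (h zero) (sum-mono-< (h ∘ suc) w l)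

-- Serves the two summands of `ΣK y s` that are always 1, at `j` and at `s`: against the constant
-- bounds 0 and 2 they gain one unit each.
sum-mono-<₂ : ∀ {m} {f g : Fin m → ℕ} → (∀ u → f u ≤ g u) →
  ∀ v w → v ≢ w → f v < g v → f w < g w → 2 + sum f ≤ sum g
sum-mono-<₂ {suc m} h zero    zero    ≢ _  _  = contradiction refl ≢
sum-mono-<₂ {suc m} {f} h zero (suc w) _ lv lw =
  ≤-trans (≤-reflexive (cong suc (sym (+-suc (f zero) _)))) (+-mono-≤ lv (sum-mono-< (h ∘ suc) w lw))
sum-mono-<₂ {suc m} {f} h (suc v) zero _ lv lw =
  ≤-trans (≤-reflexive (cong suc (sym (+-suc (f zero) _)))) (+-mono-≤ lw (sum-mono-< (h ∘ suc) v lv))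
sum-mono-<₂ {suc m} {f} {g} h (suc v) (suc w) ≢ lv lw =
  balance-≤ (+-mono-≤ (h zero) (sum-mono-<₂ {f = f ∘ suc} {g = g ∘ suc} (h ∘ suc) v w (≢ ∘ cong suc) lv lw))
      (arith (f zero) (sum (f ∘ suc)) (g zero) (sum (g ∘ suc)))
  where
  arith : ∀ a b c d → 2 + (a + b) + (c + d) ≡ c + d + (a + (2 + b))
  arith = solve-∀

-- Changing one summand, without subtraction. With `g` constantly 0 it evaluates a sum that has at
-- most one nonzero term.
sum-swap-at : ∀ {m} {f g : Fin m → ℕ} s → (∀ u → u ≢ s → f u ≡ g u) → sum f + g s ≡ sum g + f s
sum-swap-at {suc m} {f} {g} zero h
  rewrite sum-cong-≗ {x = f ∘ suc} {y = g ∘ suc} (λ u → h (suc u) λ ()) = arith (f zero) (g zero) _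
  where
  arith : ∀ a b c → a + c + b ≡ b + c + a
  arith = solve-∀
sum-swap-at {suc m} {f} {g} (suc s) h = begin
  f zero + sum (f ∘ suc) + g (suc s)   ≡⟨ +-assoc (f zero) _ _ ⟩
  f zero + (sum (f ∘ suc) + g (suc s)) ≡⟨ cong₂ _+_ (h zero λ ())
      (sum-swap-at {f = f ∘ suc} {g = g ∘ suc} s λ u u≢s → h (suc u) (u≢s ∘ FinP.suc-injective)) ⟩
  g zero + (sum (g ∘ suc) + f (suc s)) ≡⟨ +-assoc (g zero) _ _ ⟨
  g zero + sum (g ∘ suc) + f (suc s)   ∎
  where open ≡-Reasoning

-- The lexicographic order of labels

Lex : ∀ {m} → (Fin m → ℕ) → Fin m → Fin m → Set
Lex y u s = y u < y s ⊎ (y u ≡ y s × toℕ u < toℕ s)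

lex? : ∀ {m} (y : Fin m → ℕ) u s → Dec (Lex y u s)
lex? y u s = (y u <? y s) ⊎-dec ((y u ℕ.≟ y s) ×-dec (toℕ u <? toℕ s))

module _ {m} (y : Fin m → ℕ) where

  lex-irrefl : ∀ {s} → ¬ Lex y s s
  lex-irrefl (inj₁ l)       = <-irrefl refl l
  lex-irrefl (inj₂ (_ , l)) = <-irrefl refl l

  lex-trans : ∀ {s t u} → Lex y s t → Lex y t u → Lex y s u
  lex-trans (inj₁ p)       (inj₁ p′)        = inj₁ (<-trans p p′)
  lex-trans (inj₁ p)       (inj₂ (e , _))   = inj₁ (<-≤-trans p (≤-reflexive e))
  lex-trans (inj₂ (e , _)) (inj₁ p)         = inj₁ (≤-<-trans (≤-reflexive e) p)
  lex-trans (inj₂ (e , l)) (inj₂ (e′ , l′)) = inj₂ (trans e e′ , <-trans l l′)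

  lex-total : ∀ {s t} → s ≢ t → Lex y s t ⊎ Lex y t s
  lex-total {s} {t} s≢t with <-cmp (y s) (y t)
  ... | tri< l _ _ = inj₁ (inj₁ l)
  ... | tri> _ _ l = inj₂ (inj₁ l)
  ... | tri≈ _ e _ with <-cmp (toℕ s) (toℕ t)
  ...   | tri< l _ _ = inj₁ (inj₂ (e , l))
  ...   | tri≈ _ s≡t _ = contradiction (FinP.toℕ-injective s≡t) s≢t
  ...   | tri> _ _ l = inj₂ (inj₂ (sym e , l))

  lex⇒≤ : ∀ {s t} → Lex y s t → y s ≤ y t
  lex⇒≤ (inj₁ l)       = <⇒≤ l
  lex⇒≤ (inj₂ (e , _)) = ≤-reflexive e

-- Counting with duplicate-free lists and products of lists

module _ {A : Set} where

  -- Turns a bijection into an equality of cardinalities: only membership has to be compared, never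
  -- the order of listing.
  length-unique : ∀ {xs ys : List A} → Unique xs → Unique ys →
    (∀ {x} → x ∈ xs → x ∈ ys) → (∀ {x} → x ∈ ys → x ∈ xs) → length xs ≡ length ys
  length-unique u v f g = ↭-length (∼bag⇒↭ (unique∧set⇒bag u v (mk⇔ f g)))

  module _ {B : Set} where

    map-unique : ∀ {f : A → B} {xs} → (∀ {x y} → x ∈ xs → y ∈ xs → f x ≡ f y → x ≡ y) → Unique xs → Unique
        (map f xs)
    map-unique inj [] = []
    map-unique inj (x∉ ∷ u) =
      AllP.map⁺ (All.tabulate λ y∈ e → All.lookup x∉ y∈ (inj (here refl) (there y∈) e))
      ∷ map-unique (λ x∈ y∈ → inj (there x∈) (there y∈)) u

    concatMap-unique : ∀ {f : A → List B} {xs} → Unique xs → (∀ x → Unique (f x)) →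
      (∀ {x x′ y} → y ∈ f x → y ∈ f x′ → x ≡ x′) → Unique (concatMap f xs)
    concatMap-unique [] _ _ = []
    concatMap-unique {f} {x ∷ xs} (x∉ ∷ u) uf disj = Uniq.++⁺ (uf x) (concatMap-unique u uf disj) λ { (y∈ , y∈′) →
      let (x′ , x′∈ , y∈fx′) = find (∈-concatMap⁻ f y∈′) in All.lookup x∉ x′∈ (disj y∈ y∈fx′) }

    length-concatMap : ∀ (f : A → List B) xs {n} → (∀ {x} → x ∈ xs → length (f x) ≡ n) → length (concatMap f xs)
        ≡ length xs * n
    length-concatMap f []       h = refl
    length-concatMap f (x ∷ xs) h = trans (length-++ (f x))
        (cong₂ _+_ (h (here refl)) (length-concatMap f xs (h ∘ there)))

  cart : ∀ {m} → (Fin m → List A) → List (Vec A m)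
  cart {zero}  L = [ [] ]
  cart {suc m} L = concatMap (λ x → map (x ∷_) (cart (L ∘ suc))) (L zero)

  cart-unique : ∀ {m} {L : Fin m → List A} → (∀ t → Unique (L t)) → Unique (cart L)
  cart-unique {zero}  u = [] ∷ []
  cart-unique {suc m} u = concatMap-unique (u zero) (λ x → Uniq.map⁺ VecP.∷-injectiveʳ (cart-unique (u ∘ suc)))
      heads
    where
    heads : ∀ {x x′ y} {ys : List (Vec A m)} → y ∈ map (x ∷_) ys → y ∈ map (x′ ∷_) ys → x ≡ x′
    heads p p′ with ∈-map⁻ _ p | ∈-map⁻ _ p′
    ... | _ , _ , refl | _ , _ , refl = refl

  ∈-cart⁺ : ∀ {m} {L : Fin m → List A} {y : Vec A m} → (∀ t → lookup y t ∈ L t) → y ∈ cart L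
  ∈-cart⁺ {y = []}    h = here refl
  ∈-cart⁺ {y = x ∷ y} h = ∈-concatMap⁺ _ (lose (h zero) (∈-map⁺ (x ∷_) (∈-cart⁺ (h ∘ suc))))

  ∈-cart⁻ : ∀ {m} {L : Fin m → List A} {y : Vec A m} → y ∈ cart L → ∀ t → lookup y t ∈ L t
  ∈-cart⁻ {suc m} {L} y∈ t with find (∈-concatMap⁻ (λ x → map (x ∷_) (cart (L ∘ suc))) {xs = L zero} y∈)
  ... | x , x∈ , p with ∈-map⁻ (x ∷_) p | t
  ...   | y′ , y′∈ , refl | zero   = x∈
  ...   | y′ , y′∈ , refl | suc t′ = ∈-cart⁻ y′∈ t′

  length-cart-suc : ∀ {m} (L : Fin (suc m) → List A) → length (cart L) ≡ length (L zero) * length (cart (L ∘ suc))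
  length-cart-suc L = length-concatMap _ (L zero) λ _ → length-map _ (cart (L ∘ suc))

  length-cart-const : ∀ m (xs : List A) → length (cart {m} (λ _ → xs)) ≡ length xs ^ m
  length-cart-const zero    xs = refl
  length-cart-const (suc m) xs = trans (length-cart-suc {m} (λ _ → xs))
      (cong (length xs *_) (length-cart-const m xs))

  module Zones (α β γ δ : A) where

    -- What is left of `zone` once the index of `i` has been passed, so that the length computation
    -- can keep peeling off the first coordinate.
    zone′ : ℕ → ℕ → A
    zone′ j t = if does (t <? j) then β else if does (j <? t) then γ else δ

    zone : ℕ → ℕ → ℕ → A
    zone i j t = if does (t <? i) then α else if does (i <? t) then zone′ j t else δ

    module _ {i j t : ℕ} where

      zone-before : t < i → zone i j t ≡ α
      zone-before l rewrite dec-true (t <? i) l = refl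

      zone-between : i < t → t < j → zone i j t ≡ β
      zone-between l l′ rewrite dec-false (t <? i) (<-asym l) | dec-true (i <? t) l | dec-true (t <? j) l′ = refl

      zone-after : i < j → j < t → zone i j t ≡ γ
      zone-after l l′ rewrite dec-false (t <? i) (<-asym (<-trans l l′)) | dec-true (i <? t) (<-trans l l′)
                            | dec-false (t <? j) (<-asym l′) | dec-true (j <? t) l′ = refl

    zone-i : ∀ i j → zone i j i ≡ δ
    zone-i i j rewrite dec-false (i <? i) (<-irrefl refl) = refl

    zone-j : ∀ {i j} → i < j → zone i j j ≡ δ
    zone-j {i} {j} l rewrite dec-false (j <? i) (<-asym l) | dec-true (i <? j) l | dec-false (j <? j)
        (<-irrefl refl) = refl

    zone-elim : ∀ {i j} → i < j → (R : A → Set) → ∀ t → (t < i → R α) → (i < t → t < j → R β) → (j < t → R γ) →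
      (t ≡ i ⊎ t ≡ j → R δ) → R (zone i j t)
    zone-elim {i} {j} i<j R t a b c d with <-cmp t i
    ... | tri< l _ _ = subst R (sym (zone-before {i} {j} {t} l)) (a l)
    ... | tri≈ _ refl _ = subst R (sym (zone-i i j)) (d (inj₁ refl))
    ... | tri> _ _ l with <-cmp t j
    ...   | tri< l′ _ _ = subst R (sym (zone-between {i} {j} {t} l l′)) (b l l′)
    ...   | tri≈ _ refl _ = subst R (sym (zone-j i<j)) (d (inj₂ refl))
    ...   | tri> _ _ l′ = subst R (sym (zone-after {i} {j} {t} i<j l′)) (c l′)

module _ {A : Set} (α β γ δ : List A) where
  open Zones α β γ δ

  length-zone′ : ∀ m j → j < m →
    length (cart {m = m} (λ t → zone′ j (toℕ t))) ≡ length β ^ j * (length δ * length γ ^ (m ∸ suc j))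
  length-zone′ (suc m) zero    _       = begin
    length (cart {m = suc m} (λ t → zone′ 0 (toℕ t)))  ≡⟨ length-cart-suc {m = m} (λ t → zone′ 0 (toℕ t)) ⟩
    length δ * length (cart {m = m} (λ _ → γ)) ≡⟨ cong (length δ *_) (length-cart-const m γ) ⟩
    length δ * length γ ^ m                ≡⟨ +-identityʳ _ ⟨
    1 * (length δ * length γ ^ m)          ∎
    where open ≡-Reasoning
  length-zone′ (suc m) (suc j) (s≤s j<m) = begin
    length (cart {m = suc m} (λ t → zone′ (suc j) (toℕ t)))             ≡⟨ length-cart-suc {m = m}
        (λ t → zone′ (suc j) (toℕ t)) ⟩
    length β * length (cart {m = m} (λ t → zone′ j (toℕ t))) ≡⟨ cong (length β *_) (length-zone′ m j j<m) ⟩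
    length β * (length β ^ j * _)                           ≡⟨ *-assoc (length β) _ _ ⟨
    length β * length β ^ j * _                             ∎
    where open ≡-Reasoning

  length-zone : ∀ m i j → i < j → j < m →
    length (cart {m = m} (λ t → zone i j (toℕ t))) ≡
    length α ^ i * (length δ * (length β ^ (j ∸ suc i) * (length δ * length γ ^ (m ∸ suc j))))
  length-zone (suc m) zero    (suc j) _ (s≤s j<m) = begin
    length (cart {m = suc m} (λ t → zone 0 (suc j) (toℕ t)))            ≡⟨ length-cart-suc {m = m}
        (λ t → zone 0 (suc j) (toℕ t)) ⟩
    length δ * length (cart {m = m} (λ t → zone′ j (toℕ t))) ≡⟨ cong (length δ *_) (length-zone′ m j j<m) ⟩
    length δ * (length β ^ j * _)                           ≡⟨ +-identityʳ _ ⟨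
    1 * (length δ * (length β ^ j * _))                     ∎
    where open ≡-Reasoning
  length-zone (suc m) (suc i) (suc j) (s≤s i<j) (s≤s j<m) = begin
    length (cart {m = suc m} (λ t → zone (suc i) (suc j) (toℕ t)))       ≡⟨ length-cart-suc {m = m}
        (λ t → zone (suc i) (suc j) (toℕ t)) ⟩
    length α * length (cart {m = m} (λ t → zone i j (toℕ t))) ≡⟨ cong (length α *_) (length-zone m i j i<j j<m) ⟩
    length α * (length α ^ i * _)                            ≡⟨ *-assoc (length α) _ _ ⟨
    length α * length α ^ i * _                              ∎
    where open ≡-Reasoning

points≡cart : ∀ q m → points q m ≡ cart {m = m} (λ _ → upTo q)
points≡cart q zero    = refl
points≡cart q (suc m) = cong (λ ps → concatMap (λ x → map (x ∷_) ps) (upTo q)) (points≡cart q m)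

others : ℕ → ℕ → List ℕ
others b d = filter (λ v → ¬? (v ℕ.≟ d)) (upTo b)

module _ {b d : ℕ} where

  others-unique : Unique (others b d)
  others-unique = Uniq.filter⁺ (λ v → ¬? (v ℕ.≟ d)) (Uniq.upTo⁺ b)

  ∈-others⁺ : ∀ {v} → v < b → v ≢ d → v ∈ others b d
  ∈-others⁺ v<b = ∈-filter⁺ (λ v → ¬? (v ℕ.≟ d)) (∈-upTo⁺ v<b)

  ∈-others⁻ : ∀ {v} → v ∈ others b d → v < b × v ≢ d
  ∈-others⁻ v∈ with ∈-filter⁻ (λ v → ¬? (v ℕ.≟ d)) {xs = upTo b} v∈
  ... | v∈′ , v≢d = ∈-upTo⁻ v∈′ , v≢d

  length-others : d < b → suc (length (others b d)) ≡ b
  length-others d<b = trans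
    (length-unique {xs = d ∷ others b d}
      (All.tabulate (λ v∈ e → proj₂ (∈-others⁻ v∈) (sym e)) ∷ others-unique) (Uniq.upTo⁺ b)
      (λ { (here refl) → ∈-upTo⁺ d<b ; (there v∈) → ∈-upTo⁺ (proj₁ (∈-others⁻ v∈)) })
      back)
    (length-upTo b)
    where
    back : ∀ {v} → v ∈ upTo b → v ∈ d ∷ others b d
    back {v} v∈ with v ℕ.≟ d
    ... | yes refl = here refl
    ... | no v≢d   = there (∈-others⁺ (∈-upTo⁻ v∈) v≢d)

-- The hyperplanes of the arrangement and their equations modulo `q`

data Shi {m} : Hyp m → Set where
  coord : ∀ s → Shi (e s , + 0)
  coord₁ : ∀ s → Shi (e s , + 1)
  plus : ∀ {s t} → toℕ s < toℕ t → Shi (e s ⊕ e t , + 0)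
  plus₁ : ∀ {s t} → toℕ s < toℕ t → Shi (e s ⊕ e t , + 1)
  minus : ∀ {s t} → toℕ s < toℕ t → Shi (e s ⊖ e t , + 0)
  minus₁ : ∀ {s t} → toℕ s < toℕ t → Shi (e s ⊖ e t , + 1)

∈-shiB⁻ : ∀ {m} {H : Hyp m} → H ∈ shiB m → Shi H
∈-shiB⁻ {m} H∈ with ∈-++⁻ (concatMap (λ s → (e s , + 0) ∷ (e s , + 1) ∷ []) (allFin m)) H∈
... | inj₁ H∈₁ with find (∈-concatMap⁻ (λ s → (e s , + 0) ∷ (e s , + 1) ∷ []) {xs = allFin m} H∈₁)
...   | s , _ , here refl         = coord s
...   | s , _ , there (here refl) = coord₁ s
∈-shiB⁻ {m} H∈ | inj₂ H∈₂ with find (∈-concatMap⁻ _ {xs = allFin m} H∈₂)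
... | s , _ , H∈₃ with find (∈-concatMap⁻ _ {xs = filter (λ t → s FinP.<? t) (allFin m)} H∈₃)
...   | t , t∈ , H∈₄ with proj₂ (∈-filter⁻ (λ t → s FinP.<? t) {xs = allFin m} t∈) | H∈₄
...     | s<t | here refl                         = plus s<t
...     | s<t | there (here refl)                 = plus₁ s<t
...     | s<t | there (there (here refl))         = minus s<t
...     | s<t | there (there (there (here refl))) = minus₁ s<t

∈-shiB⁺ : ∀ {m} {H : Hyp m} → Shi H → H ∈ shiB m
∈-shiB⁺ {m} = go
  where
  left : ∀ {H} s → H ∈ (e s , + 0) ∷ (e s , + 1) ∷ [] → H ∈ shiB m
  left s H∈ = ∈-++⁺ˡ (∈-concatMap⁺ _ (lose (∈-allFin s) H∈))
  right : ∀ {H} {s t} → toℕ s < toℕ t →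
    H ∈ (e s ⊕ e t , + 0) ∷ (e s ⊕ e t , + 1) ∷ (e s ⊖ e t , + 0) ∷ (e s ⊖ e t , + 1) ∷ [] → H ∈ shiB m
  right {H} {s} {t} s<t H∈ = ∈-++⁺ʳ _ (∈-concatMap⁺ _ (lose (∈-allFin s)
    (∈-concatMap⁺ _ (lose (∈-filter⁺ (λ t → s FinP.<? t) (∈-allFin t) s<t) H∈))))
  go : ∀ {H} → Shi H → H ∈ shiB m
  go (coord s)   = left s (here refl)
  go (coord₁ s)  = left s (there (here refl))
  go (plus l)    = right l (here refl)
  go (plus₁ l)   = right l (there (here refl))
  go (minus l)   = right l (there (there (here refl)))
  go (minus₁ l)  = right l (there (there (there (here refl))))

lookup-e-same : ∀ {m} (s : Fin m) → lookup (e s) s ≡ + 1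
lookup-e-same s with s ≟ s | (lookup (e s) s ≡ _ ∋ VecP.lookup∘tabulate _ s)
... | yes _  | eq = eq
... | no s≢s | _  = contradiction refl s≢s

lookup-e-other : ∀ {m} {s k : Fin m} → k ≢ s → lookup (e s) k ≡ + 0
lookup-e-other {s = s} {k} k≢s with k ≟ s | (lookup (e s) k ≡ _ ∋ VecP.lookup∘tabulate _ k)
... | yes k≡s | _  = contradiction k≡s k≢s
... | no _    | eq = eq

dot-zero : ∀ {m} (a : Vec ℤ m) (x : Vec ℕ m) → (∀ k → lookup a k ≡ + 0) → dot a x ≡ + 0
dot-zero []      []      _ = refl
dot-zero (c ∷ a) (v ∷ x) h rewrite h zero | dot-zero a x (h ∘ suc) = refl

dot-unit : ∀ {m} (a : Vec ℤ m) (x : Vec ℕ m) s → lookup a s ≡ + 1 → (∀ k → k ≢ s → lookup a k ≡ + 0) →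
  dot a x ≡ + lookup x s
dot-unit (c ∷ a) (v ∷ x) zero    refl h rewrite dot-zero a x (λ k → h (suc k) λ ()) =
  trans (ℤP.+-identityʳ _) (ℤP.*-identityˡ (+ v))
dot-unit (c ∷ a) (v ∷ x) (suc s) h₁ h rewrite h zero (λ ()) =
  trans (ℤP.+-identityˡ _) (dot-unit a x s h₁ λ k k≢s → h (suc k) (k≢s ∘ FinP.suc-injective))

dot-e : ∀ {m} (s : Fin m) x → dot (e s) x ≡ + lookup x s
dot-e s x = dot-unit (e s) x s (lookup-e-same s) λ k → lookup-e-other

dot-⊕ : ∀ {m} (u v : Vec ℤ m) x → dot (u ⊕ v) x ≡ dot u x ℤ.+ dot v x
dot-⊕ []      []      []      = refl
dot-⊕ (c ∷ u) (d ∷ v) (k ∷ x) = trans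
  (cong₂ ℤ._+_ (ℤP.*-distribʳ-+ (+ k) c d) (dot-⊕ u v x))
  (interchange (c ℤ.* + k) (d ℤ.* + k) (dot u x) (dot v x))

dot-⊖ : ∀ {m} (u v : Vec ℤ m) x → dot (u ⊖ v) x ≡ dot u x ℤ.- dot v x
dot-⊖ []      []      []      = refl
dot-⊖ (c ∷ u) (d ∷ v) (k ∷ x) = begin
  (c ℤ.- d) ℤ.* + k ℤ.+ dot (u ⊖ v) x
    ≡⟨ cong₂ ℤ._+_ (ℤP.*-distribʳ-+ (+ k) c (ℤ.- d)) (dot-⊖ u v x) ⟩
  (c ℤ.* + k ℤ.+ (ℤ.- d) ℤ.* + k) ℤ.+ (dot u x ℤ.- dot v x)
    ≡⟨ cong (λ z → (c ℤ.* + k ℤ.+ z) ℤ.+ (dot u x ℤ.- dot v x)) (sym (ℤP.neg-distribˡ-* d (+ k))) ⟩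
  (c ℤ.* + k ℤ.- d ℤ.* + k) ℤ.+ (dot u x ℤ.- dot v x)
    ≡⟨ interchange (c ℤ.* + k) _ (dot u x) _ ⟩
  (c ℤ.* + k ℤ.+ dot u x) ℤ.+ (ℤ.- (d ℤ.* + k) ℤ.- dot v x)
    ≡⟨ cong (λ z → c ℤ.* + k ℤ.+ dot u x ℤ.+ z) (sym (ℤP.neg-distrib-+ (d ℤ.* + k) (dot v x))) ⟩
  (c ℤ.* + k ℤ.+ dot u x) ℤ.- (d ℤ.* + k ℤ.+ dot v x) ∎
  where open ≡-Reasoning

module _ {q : ℕ} .⦃ _ : NonZero q ⦄ where

  ∣-sub : ∀ {a c} → c ≤ a → ∣ + a ℤ.- + c ∣ ≡ a ∸ c
  ∣-sub {a} {c} c≤a = cong ∣_∣ (trans (ℤP.m-n≡m⊖n a c) (ℤP.⊖-≥ c≤a))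

  multiple<q : ∀ {w} → w < q → q ∣ w → w ≡ 0
  multiple<q {zero}  _   _   = refl
  multiple<q {suc w} w<q q∣w = contradiction (ℕD.∣⇒≤ q∣w) (<⇒≱ w<q)

  -- The two bounds say that `a` and `c` differ by less than `q`, and 0 is the only multiple of `q`
  -- that small.
  congruent-near : ∀ {a c} → a < c + q → c < a + q → q ∣ ∣ + a ℤ.- + c ∣ → a ≡ c
  congruent-near {a} {c} a< c< d with ≤-total c a
  ... | inj₁ c≤a = ≤-antisym (m∸n≡0⇒m≤n (multiple<q (m<n+o⇒m∸n<o a c a<) (subst (q ∣_) (∣-sub c≤a) d))) c≤a
  ... | inj₂ a≤c = ≤-antisym a≤c (m∸n≡0⇒m≤n (multiple<q (m<n+o⇒m∸n<o c a c<)
    (subst (q ∣_) (trans (ℤP.∣i-j∣≡∣j-i∣ (+ a) (+ c)) (∣-sub a≤c)) d)))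

  congruent-refl : ∀ {a c} → a ≡ c → q ∣ ∣ + a ℤ.- + c ∣
  congruent-refl {a} refl rewrite ℤP.+-inverseʳ (+ a) = q ℕD.∣0

  -- The difference lies strictly between 0 and `2q`, where `q` is the only multiple.
  congruent-above : ∀ {a c} → c < a → a < c + q + q → q ∣ ∣ + a ℤ.- + c ∣ → a ≡ c + q
  congruent-above {a} {c} c<a a< d = trans (sym (m+[n∸m]≡n (<⇒≤ c<a))) (cong (λ z → c + z) (≤-antisym below above))
    where
    d′ : q ∣ a ∸ c
    d′ = subst (q ∣_) (∣-sub (<⇒≤ c<a)) d
    above : q ≤ a ∸ c
    above = ℕD.∣⇒≤ ⦃ >-nonZero (m<n⇒0<n∸m c<a) ⦄ d′
    below : a ∸ c ≤ q
    below = m∸n≡0⇒m≤n (multiple<q (m<n+o⇒m∸n<o (a ∸ c) q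
        (m<n+o⇒m∸n<o a c ⦃ >-nonZero (≤-trans (>-nonZero⁻¹ q) (m≤m+n q q)) ⦄ (subst (a <_) (+-assoc c q q) a<)))
      (ℕD.∣m+n∣m⇒∣n (subst (q ∣_) (sym (m+[n∸m]≡n above)) d′) ℕD.∣-refl))

  congruent-shift : ∀ {a c} → a ≡ c + q → q ∣ ∣ + a ℤ.- + c ∣
  congruent-shift {c = c} refl = subst (q ∣_) (sym (trans (∣-sub (m≤m+n c q)) (m+n∸m≡n c q))) ℕD.∣-refl

module _ {m} {x : Vec ℕ m} {q : ℕ} where

  ∈-coord : ∀ {s c} → x ∈[ q ] (e s , + c) → q ∣ ∣ + lookup x s ℤ.- + c ∣
  ∈-coord {s} {c} = subst (λ z → q ∣ ∣ z ℤ.- + c ∣) (dot-e s x)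

  ∈-coord⁺ : ∀ {s c} → q ∣ ∣ + lookup x s ℤ.- + c ∣ → x ∈[ q ] (e s , + c)
  ∈-coord⁺ {s} {c} = subst (λ z → q ∣ ∣ z ℤ.- + c ∣) (sym (dot-e s x))

  dot-plus : ∀ s t → dot (e s ⊕ e t) x ≡ + (lookup x s + lookup x t)
  dot-plus s t = trans (dot-⊕ (e s) (e t) x) (cong₂ ℤ._+_ (dot-e s x) (dot-e t x))

  dot-minus : ∀ s t c → dot (e s ⊖ e t) x ℤ.- + c ≡ + lookup x s ℤ.- + (c + lookup x t)
  dot-minus s t c = begin
    dot (e s ⊖ e t) x ℤ.- + c                      ≡⟨ cong (ℤ._- + c)
        (trans (dot-⊖ (e s) (e t) x) (cong₂ ℤ._-_ (dot-e s x) (dot-e t x))) ⟩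
    + lookup x s ℤ.- + lookup x t ℤ.- + c          ≡⟨ ℤP.+-assoc (+ lookup x s) (ℤ.- + lookup x t) (ℤ.- + c) ⟩
    + lookup x s ℤ.+ (ℤ.- + lookup x t ℤ.- + c)    ≡⟨ cong (λ z → + lookup x s ℤ.+ z)
        (ℤP.neg-distrib-+ (+ lookup x t) (+ c)) ⟨
    + lookup x s ℤ.- + (lookup x t + c)            ≡⟨ cong (λ z → + lookup x s ℤ.- + z) (+-comm (lookup x t) c) ⟩
    + lookup x s ℤ.- + (c + lookup x t)            ∎
    where open ≡-Reasoning

  ∈-plus⁺ : ∀ {s t c} .⦃ _ : NonZero q ⦄ → lookup x s + lookup x t ≡ c + q → x ∈[ q ] (e s ⊕ e t , + c)
  ∈-plus⁺ {s} {t} {c} eq = subst (λ z → q ∣ ∣ z ℤ.- + c ∣) (sym (dot-plus s t)) (congruent-shift eq)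

  ∈-minus⁺ : ∀ {s t} c .⦃ _ : NonZero q ⦄ → lookup x s ≡ c + lookup x t → x ∈[ q ] (e s ⊖ e t , + c)
  ∈-minus⁺ {s} {t} c eq = subst (λ z → q ∣ ∣ z ∣) (sym (dot-minus s t c)) (congruent-refl eq)

lookup-injective : ∀ {A : Set} {m} {x y : Vec A m} → (∀ s → lookup x s ≡ lookup y s) → x ≡ y
lookup-injective {x = x} {y} h = trans (sym (VecP.tabulate∘lookup x))
    (trans (VecP.tabulate-cong h) (VecP.tabulate∘lookup y))

-- Positions computed from a choice of values

module Restriction (m : ℕ) (i j : Fin m) (i<j : toℕ i < toℕ j)
                   (q b : ℕ) (q≡ : q + 2 ≡ b + m * 2) ⦃ _ : NonZero q ⦄ where

  i≢j : i ≢ j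
  i≢j refl = <-irrefl refl i<j

  -- A label following i has to follow j as well, as both sit at the same place.
  hi : Fin m → ℕ
  hi u = if does (u ≟ i) then toℕ j else toℕ u

  hi-i : hi i ≡ toℕ j
  hi-i rewrite dec-true (i ≟ i) refl = refl

  ≤hi : ∀ u → toℕ u ≤ hi u
  ≤hi u with u ≟ i
  ... | yes refl = <⇒≤ i<j
  ... | no _     = ≤-refl

  -- j is identified with i and must not be counted again.  The value 1 for u = j and u = s
  -- normalises the sums so that Σ_u (K u s + K u t) is compared with 2m, where q + 2 = b + 2m.
  K : (Fin m → Fin m → ℕ) → Fin m → Fin m → ℕ
  K A u s = if does (u ≟ j) then 1 else if does (u ≟ s) then 1 else A u s

  module _ (A : Fin m → Fin m → ℕ) where

    K-ghost : ∀ s → K A j s ≡ 1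
    K-ghost s rewrite dec-true (j ≟ j) refl = refl

    K-self : ∀ {s} → s ≢ j → K A s s ≡ 1
    K-self {s} s≢j rewrite dec-false (s ≟ j) s≢j | dec-true (s ≟ s) refl = refl

    K-other : ∀ {u s} → u ≢ j → u ≢ s → K A u s ≡ A u s
    K-other {u} {s} u≢j u≢s rewrite dec-false (u ≟ j) u≢j | dec-false (u ≟ s) u≢s = refl

    K-elim : ∀ {ℓ} (R : ℕ → Set ℓ) u s → R 1 → (u ≢ j → u ≢ s → R (A u s)) → R (K A u s)
    K-elim R u s r f with u ≟ j
    ... | yes _ = r
    ... | no u≢j with u ≟ s
    ...   | yes _ = r
    ...   | no u≢s = f u≢j u≢s

  -- The first summand records whether u lies below s, the second whether −u does.
  before : (Fin m → ℕ) → Fin m → Fin m → ℕ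
  before y u s = ind (lex? y u s) + ind (b ≤? suc (y u + y s))

  ΣK : (Fin m → ℕ) → Fin m → ℕ
  ΣK y s = sum (λ u → K (before y) u s)

  position : (Fin m → ℕ) → Fin m → ℕ
  position y s = y s + ΣK y s

  module _ (y : Fin m → ℕ) where

    before≤2 : ∀ u s → before y u s ≤ 2
    before≤2 u s = +-mono-≤ (ind≤1 (lex? y u s)) (ind≤1 (b ≤? suc (y u + y s)))

    2≤position : ∀ {s} → s ≢ j → 2 ≤ position y s
    2≤position {s} s≢j = ≤-trans
      (≤-trans (m≤m+n 2 _)
        (sum-mono-<₂ {f = λ _ → 0} (λ _ → z≤n) j s (s≢j ∘ sym)
          (≤-reflexive (sym (K-ghost (before y) s))) (≤-reflexive (sym (K-self (before y) s≢j)))))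
      (m≤n+m _ (y s))

    position<q : ∀ {s} → s ≢ j → y s < b → position y s < q
    position<q {s} s≢j y<b = balance-≤ (+-mono-≤ y<b (+-mono-≤ bound (≤-reflexive (sym q≡))))
        (arith (y s) (ΣK y s) b (m * 2) q)
      where
      -- Each of the `m` terms is at most 2, and those at `j` and `s` are 1; hence y_s + `ΣK` is
      -- below b + 2m - 2 = q.
      bound : 2 + ΣK y s ≤ m * 2
      bound = ≤-trans (sum-mono-<₂ {f = λ u → K (before y) u s} {g = λ _ → 2}
        (λ u → K-elim (before y) (_≤ 2) u s (s≤s z≤n) (λ _ _ → before≤2 u s)) j s (s≢j ∘ sym)
        (≤-reflexive (cong suc (K-ghost (before y) s))) (≤-reflexive (cong suc (K-self (before y) s≢j))))
        (≤-reflexive (sum-const m 2))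
      arith : ∀ y k b n q → suc (y + k) + (b + (n + (q + 2))) ≡ q + (suc y + ((2 + k) + (b + n)))
      arith = solve-∀

    ΣKK : ∀ s t → sum (λ u → K (before y) u s + K (before y) u t) ≡ ΣK y s + ΣK y t
    ΣKK s t = ∑-distrib-+ (λ u → K (before y) u s) (λ u → K (before y) u t)

    module _ {s t} (s≢j : s ≢ j) (t≢j : t ≢ j) (l : Lex y t s) where
      private
        t≢s : t ≢ s
        t≢s refl = lex-irrefl y l

        ¬l : ¬ Lex y s t
        ¬l l′ = lex-irrefl y (lex-trans y l l′)

        Kts : K (before y) t s ≡ 1 + ind (b ≤? suc (y t + y s))
        Kts = trans (K-other (before y) t≢j t≢s) (cong (_+ _) (ind-yes (lex? y t s) l))

        Kst : K (before y) s t ≡ ind (b ≤? suc (y s + y t))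
        Kst = trans (K-other (before y) s≢j (t≢s ∘ sym))
                    (cong (_+ _) (ind-no (lex? y s t) ¬l))

      -- Let ε be the indicator of b ≤ y_s + y_t + 1. From `t` to `s` the term of `t` goes from 1 to
      -- 1 + ε and the term of `s` from ε to 1: exactly one of the two grows, by 1. No other term
      -- decreases.
      ΣK-mono : ΣK y t < ΣK y s
      ΣK-mono = [ strict-at-t , strict-at-s ]′ (≤-total b (suc (y t + y s)))
        where
        pointwise : ∀ u → K (before y) u t ≤ K (before y) u s
        pointwise u with u ≟ j | u ≟ t | u ≟ s
        ... | yes _   | _        | _        = ≤-refl
        ... | no _    | yes refl | yes refl = ≤-refl
        ... | no _    | yes refl | no _     = subst (λ k → 1 ≤ k + _) (sym (ind-yes (lex? y t s) l)) (s≤s z≤n)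
        ... | no _    | no _     | yes refl =
          subst (λ k → k + _ ≤ 1) (sym (ind-no (lex? y s t) ¬l)) (ind≤1 (b ≤? suc (y s + y t)))
        ... | no _    | no _     | no _     = +-mono-≤
          (ind-mono (lex? y u t) (lex? y u s) (λ l′ → lex-trans y l′ l))
          (ind-mono (b ≤? suc (y u + y t)) (b ≤? suc (y u + y s))
            (λ h → ≤-trans h (s≤s (+-monoʳ-≤ (y u) (lex⇒≤ y l)))))
        strict-at-t : b ≤ suc (y t + y s) → ΣK y t < ΣK y s
        strict-at-t h = sum-mono-< pointwise t (subst₂ _<_ (sym (K-self (before y) t≢j))
          (sym (trans Kts (cong suc (ind-yes (b ≤? suc (y t + y s)) h)))) ≤-refl)
        strict-at-s : suc (y t + y s) ≤ b → ΣK y t < ΣK y s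
        strict-at-s h with m≤n⇒m<n∨m≡n h
        ... | inj₂ e = strict-at-t (≤-reflexive (sym e))
        ... | inj₁ h′ = sum-mono-< pointwise s (subst₂ _<_ (sym (trans Kst (ind-no (b ≤? suc (y s + y t)) b≰)))
          (sym (K-self (before y) s≢j)) ≤-refl)
          where
          b≰ : ¬ b ≤ suc (y s + y t)
          b≰ b≤ = <⇒≱ h′ (subst (λ k → b ≤ suc k) (+-comm (y s) (y t)) b≤)

      position-mono : position y t < position y s
      position-mono = +-mono-≤-< (lex⇒≤ y l) ΣK-mono

      -- The terms are paired crosswise: a label `u` not below `s` has y_u ≥ y_s, so -u lies below
      -- `t`, and likewise with `s` and `t` exchanged. Each label thus gives at least 2, and `t`
      -- gives 3, so the sum is at least (b - 1) + (2m + 1) = q + 2.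
      position-sum-large′ : b ≤ suc (y s + y t) → suc (suc q) ≤ position y s + position y t
      position-sum-large′ h = balance-≤ (+-mono-≤ h (+-mono-≤ total (≤-reflexive q≡)))
                                  (arith q (y s) (y t) (ΣK y s) (ΣK y t) b (m * 2))
        where
        h′ : b ≤ suc (y t + y s)
        h′ = subst (λ k → b ≤ suc k) (+-comm (y s) (y t)) h
        step : ∀ u {v w} → u ≢ v → b ≤ suc (y v + y w) → 1 ≤ ind (lex? y u v) + ind (b ≤? suc (y u + y w))
        step u {v} {w} u≢v hvw = ind-exhaustive (lex? y u v) (b ≤? suc (y u + y w)) λ ¬l →
          [ (λ l′ → contradiction l′ ¬l) , (λ l′ → ≤-trans hvw (s≤s (+-monoˡ-≤ (y w) (lex⇒≤ y l′)))) ]′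
              (lex-total y u≢v)
        pointwise : ∀ u → 2 ≤ K (before y) u s + K (before y) u t
        pointwise u with u ≟ j | u ≟ s | u ≟ t
        ... | yes _ | _        | _        = ≤-refl
        ... | no _  | yes refl | yes refl = ≤-refl
        ... | no _  | yes refl | no _     = s≤s
            (subst (λ k → 1 ≤ _ + k) (sym (ind-yes (b ≤? suc (y s + y t)) h)) (m≤n+m 1 _))
        ... | no _  | no _     | yes refl = +-monoˡ-≤ 1
            (subst (λ k → 1 ≤ _ + k) (sym (ind-yes (b ≤? suc (y t + y s)) h′)) (m≤n+m 1 _))
        ... | no _  | no u≢s   | no u≢t   = balance-≤ (+-mono-≤ (step u u≢s h) (step u u≢t h′))
          (exchange (ind (lex? y u s)) (ind (b ≤? suc (y u + y s))) (ind (lex? y u t)) (ind (b ≤? suc (y u + y t))))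
          where
          exchange : ∀ a c d e → 2 + (a + e + (d + c)) ≡ a + c + (d + e) + 2
          exchange = solve-∀
        strict : 2 < K (before y) t s + K (before y) t t
        strict = ≤-reflexive (sym (cong₂ _+_ (trans Kts (cong suc (ind-yes (b ≤? suc (y t + y s)) h′)))
            (K-self (before y) t≢j)))
        total : suc (m * 2) ≤ ΣK y s + ΣK y t
        total = subst₂ (λ a c → suc a ≤ c) (sum-const m 2) (ΣKK s t) (sum-mono-< pointwise t strict)
        arith : ∀ q ys yt ks kt b n → suc (suc q) + (suc (ys + yt) + (ks + kt + (b + n))) ≡ ys + ks + (yt + kt)
            + (b + (suc n + (q + 2)))
        arith = solve-∀

      -- The same crosswise pairing gives at most 2 per label and only 1 at `s`, so the sum is at
      -- most (b - 2) + (2m - 1) = q - 1. Between the two cases it jumps over both forbidden values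
      -- `q` and `q + 1`.
      position-sum-small′ : suc (y s + y t) < b → position y s + position y t < q
      position-sum-small′ h = balance-≤ (+-mono-≤ h (+-mono-≤ total (≤-reflexive (sym q≡))))
                                  (arith q (y s) (y t) (ΣK y s) (ΣK y t) b (m * 2))
        where
        h′ : suc (y t + y s) < b
        h′ = subst (λ k → suc k < b) (+-comm (y s) (y t)) h
        step : ∀ u {v w} → suc (y v + y w) < b → ind (lex? y u v) + ind (b ≤? suc (y u + y w)) ≤ 1
        step u {v} {w} hvw = ind-exclusive (lex? y u v) (b ≤? suc (y u + y w)) λ l′ b≤ →
          <⇒≱ hvw (≤-trans b≤ (s≤s (+-monoˡ-≤ (y w) (lex⇒≤ y l′))))
        Kst≡0 : K (before y) s t ≡ 0
        Kst≡0 = trans Kst (ind-no (b ≤? suc (y s + y t)) (<⇒≱ h))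
        pointwise : ∀ u → K (before y) u s + K (before y) u t ≤ 2
        pointwise u with u ≟ j | u ≟ s | u ≟ t
        ... | yes _ | _        | _        = ≤-refl
        ... | no _  | yes refl | yes refl = ≤-refl
        ... | no _  | yes refl | no _     = s≤s
            (subst (λ k → _ + k ≤ 1) (sym (ind-no (b ≤? suc (y s + y t)) (<⇒≱ h)))
                (≤-trans (≤-reflexive (+-identityʳ _)) (ind≤1 (lex? y s t))))
        ... | no _  | no _     | yes refl = +-monoˡ-≤ 1
            (subst (λ k → _ + k ≤ 1) (sym (ind-no (b ≤? suc (y t + y s)) (<⇒≱ h′)))
                (≤-trans (≤-reflexive (+-identityʳ _)) (ind≤1 (lex? y t s))))
        ... | no _  | no u≢s   | no u≢t   = balance-≤ (+-mono-≤ (step u h) (step u h′))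
          (exchange (ind (lex? y u s)) (ind (b ≤? suc (y u + y s))) (ind (lex? y u t)) (ind (b ≤? suc (y u + y t))))
          where
          exchange : ∀ a c d e → a + c + (d + e) + 2 ≡ 2 + (a + e + (d + c))
          exchange = solve-∀
        strict : K (before y) s s + K (before y) s t < 2
        strict = ≤-reflexive (cong suc (cong₂ _+_ (K-self (before y) s≢j) Kst≡0))
        total : suc (ΣK y s + ΣK y t) ≤ m * 2
        total = subst₂ (λ a c → suc a ≤ c) (ΣKK s t) (sum-const m 2) (sum-mono-< pointwise s strict)
        arith : ∀ q ys yt ks kt b n → suc (ys + ks + (yt + kt)) + (b + (n + (q + 2))) ≡ q +
            (suc (suc (ys + yt)) + (suc (ks + kt) + (b + n)))
        arith = solve-∀

    module _ {s t} (s≢j : s ≢ j) (t≢j : t ≢ j) (s≢t : s ≢ t) where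

      position-sum-large : b ≤ suc (y s + y t) → suc (suc q) ≤ position y s + position y t
      position-sum-large h with lex-total y s≢t
      ... | inj₂ l = position-sum-large′ s≢j t≢j l h
      ... | inj₁ l = subst (suc (suc q) ≤_) (+-comm (position y t) _)
        (position-sum-large′ t≢j s≢j l (subst (λ k → b ≤ suc k) (+-comm (y s) (y t)) h))

      position-sum-small : suc (y s + y t) < b → position y s + position y t < q
      position-sum-small h with lex-total y s≢t
      ... | inj₂ l = position-sum-small′ s≢j t≢j l h
      ... | inj₁ l = subst (_< q) (+-comm (position y t) _)
        (position-sum-small′ t≢j s≢j l (subst (λ k → suc k < b) (+-comm (y s) (y t)) h))

    module _ {s} (s≢j : s ≢ j) where
      private
        k = ΣK y s

        -- For x = y_s + k one has 2x - q = (2y_s + 2 - b) + 2(k - m), so the sign of k - m decides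
        -- on which side of the middle `s` falls. A label raises `k` above `m` if it and its
        -- negative both lie below `s`, and lowers it if neither does.
        k≥m : (∀ u → u ≢ j → u ≢ s → ¬ Lex y u s → b ≤ suc (y u + y s)) → m * 1 ≤ k
        k≥m f = subst (_≤ k) (sum-const m 1) (sum-mono λ u →
          K-elim (before y) (1 ≤_) u s ≤-refl λ u≢j u≢s →
            ind-exhaustive (lex? y u s) (b ≤? suc (y u + y s)) (f u u≢j u≢s))

        k≤m : (∀ u → u ≢ j → Lex y u s → suc (y u + y s) < b) → k ≤ m * 1
        k≤m f = subst (k ≤_) (sum-const m 1) (sum-mono λ u →
          K-elim (before y) (_≤ 1) u s ≤-refl λ u≢j u≢s →
            ind-exclusive (lex? y u s) (b ≤? suc (y u + y s)) (λ l → <⇒≱ (f u u≢j l)))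

        above : b ≤ suc (y s + y s) → ∀ u → u ≢ j → u ≢ s → ¬ Lex y u s → b ≤ suc (y u + y s)
        above h u _ u≢s ¬l = [ (λ l → contradiction l ¬l) ,
            (λ l → ≤-trans h (s≤s (+-monoˡ-≤ (y s) (lex⇒≤ y l)))) ]′ (lex-total y u≢s)

        below : suc (y s + y s) < b → ∀ u → u ≢ j → Lex y u s → suc (y u + y s) < b
        below h u _ l = ≤-<-trans (s≤s (+-monoˡ-≤ (y s) (lex⇒≤ y l))) h

        large : b < suc (y s + y s) → suc q < position y s + position y s
        large h = balance-≤ (+-mono-≤ h (+-mono-≤ (+-mono-≤ (k≥m (above (<⇒≤ h))) (k≥m (above (<⇒≤ h))))
            (≤-reflexive q≡)))
          (arith q (y s) k b m)
          where
          arith : ∀ q y k b m → suc (suc q) + (suc (y + y) + (k + k + (b + m * 2))) ≡ y + k + (y + k) +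
              (suc b + (m * 1 + m * 1 + (q + 2)))
          arith = solve-∀

        small : suc (y s + y s) < b → position y s + position y s ≤ q
        small h = balance-≤ (+-mono-≤ h (+-mono-≤ (+-mono-≤ (k≤m (below h)) (k≤m (below h)))
            (≤-reflexive (sym q≡))))
          (arith q (y s) k b m)
          where
          arith : ∀ q y k b m → y + k + (y + k) + (b + (m * 1 + m * 1 + (q + 2))) ≡ q +
              (suc (suc (y + y)) + (k + k + (b + m * 2)))
          arith = solve-∀

      -- At this value every label counts at least once: one above `s` has y_u ≥ y_s, hence its
      -- negative is below `s`. It counts twice exactly when it ties with `s` and has a smaller
      -- index, so without such ties k = m.
      middle-odd⁺ : suc (y s + y s) ≡ b → (∀ u → u ≢ j → toℕ u < toℕ s → y u ≢ y s) →
        position y s + position y s ≡ suc q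
      middle-odd⁺ e f = balance-≡ (cong₂ _+_ e (cong₂ _+_ (cong₂ _+_ k≡m k≡m) (sym q≡))) (arith q (y s) k b m)
        where
        k≡m : k ≡ m * 1
        k≡m = ≤-antisym
          (k≤m λ { u u≢j (inj₁ l) → subst (suc (y u + y s) <_) e (s≤s (+-monoˡ-< (y s) l))
                 ; u u≢j (inj₂ (e′ , l)) → contradiction e′ (f u u≢j l) })
          (k≥m (above (≤-reflexive (sym e))))
        arith : ∀ q y k b m → y + k + (y + k) + (b + (m * 1 + m * 1 + (q + 2))) ≡ suc q +
            (suc (y + y) + (k + k + (b + m * 2)))
        arith = solve-∀

      -- Off the middle value, `small` and `large` keep the doubled position at most `q` or at least
      -- `q + 2`. On it, a single tie with a smaller index makes `k` exceed `m` and pushes the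
      -- doubled position past `q + 1`.
      middle-odd⁻ : position y s + position y s ≡ suc q →
        suc (y s + y s) ≡ b × (∀ u → u ≢ j → toℕ u < toℕ s → y u ≢ y s)
      middle-odd⁻ e with <-cmp (suc (y s + y s)) b
      ... | tri< l _ _ = contradiction (small l) (<⇒≱ (≤-reflexive (sym e)))
      ... | tri> _ _ l = contradiction (large l) (<⇒≱ (s≤s (≤-reflexive e)))
      ... | tri≈ _ eb _ = eb , λ u u≢j u<s yu≡ys →
        let
          b≤ = ≤-reflexive (trans (sym eb) (cong (λ z → suc (z + y s)) (sym yu≡ys)))
          two : K (before y) u s ≡ 2
          two = trans (K-other (before y) u≢j λ { refl → <-irrefl refl u<s })
            (cong₂ _+_ (ind-yes (lex? y u s) (inj₂ (yu≡ys , u<s))) (ind-yes (b ≤? suc (y u + y s)) b≤))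
          k>m : suc (m * 1) ≤ k
          k>m = subst (λ z → suc z ≤ k) (sum-const m 1) (sum-mono-< (λ v →
            K-elim (before y) (1 ≤_) v s ≤-refl λ v≢j v≢s →
            ind-exhaustive (lex? y v s) (b ≤? suc (y v + y s)) (above (≤-reflexive (sym eb)) v v≢j v≢s)) u
                (≤-reflexive (sym two)))
        in <⇒≱ {suc q} {position y s + position y s}
             (balance-≤ (+-mono-≤ (≤-reflexive (sym eb)) (+-mono-≤ (+-mono-≤ k>m (<⇒≤ k>m)) (≤-reflexive q≡)))
                 (arith q (y s) k b m))
             (≤-reflexive e)
        where
        arith : ∀ q y k b m → suc (suc q) + (suc (y + y) + (k + k + (b + m * 2))) ≡ y + k + (y + k) +
            (b + (suc (m * 1) + m * 1 + (q + 2)))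
        arith = solve-∀

      -- The mirror image of the odd case: here a label below `s` never has its negative below `s`
      -- as well, and a label contributes 0 exactly when it ties with `s` and has a larger index.
      middle-even⁺ : suc (suc (y s + y s)) ≡ b → (∀ u → u ≢ j → toℕ s < toℕ u → y u ≢ y s) →
        position y s + position y s ≡ q
      middle-even⁺ e f = balance-≡ (cong₂ _+_ e (cong₂ _+_ (cong₂ _+_ k≡m k≡m) (sym q≡))) (arith q (y s) k b m)
        where
        k≡m : k ≡ m * 1
        k≡m = ≤-antisym
          (k≤m (below (≤-reflexive e)))
          (k≥m λ u u≢j u≢s ¬l → [ (λ l → contradiction l ¬l)
                                , (λ { (inj₁ l) → subst (_≤ suc (y u + y s)) e (s≤s (+-monoˡ-< (y s) l))
                                     ; (inj₂ (e′ , l)) → contradiction (sym e′) (f u u≢j l) }) ]′ (lex-total y u≢s))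
        arith : ∀ q y k b m → y + k + (y + k) + (b + (m * 1 + m * 1 + (q + 2))) ≡ q +
            (suc (suc (y + y)) + (k + k + (b + m * 2)))
        arith = solve-∀

      middle-even⁻ : position y s + position y s ≡ q →
        suc (suc (y s + y s)) ≡ b × (∀ u → u ≢ j → toℕ s < toℕ u → y u ≢ y s)
      middle-even⁻ e with <-cmp (suc (suc (y s + y s))) b
      ... | tri< l _ _ = contradiction
        (balance-≤ (+-mono-≤ l (+-mono-≤ (+-mono-≤ (k≤m (below (<⇒≤ l))) (k≤m (below (<⇒≤ l))))
            (≤-reflexive (sym q≡)))) (arith q (y s) k b m))
        (<⇒≱ {q} {suc (position y s + position y s)} (s≤s (≤-reflexive (sym e))))
        where
        arith : ∀ q y k b m → suc (y + k + (y + k)) + (b + (m * 1 + m * 1 + (q + 2))) ≡ q +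
            (suc (suc (suc (y + y))) + (k + k + (b + m * 2)))
        arith = solve-∀
      ... | tri> _ _ l = contradiction
        (balance-≤ (+-mono-≤ (s≤s⁻¹ l) (+-mono-≤ (+-mono-≤ (k≥m (above (s≤s⁻¹ l))) (k≥m (above (s≤s⁻¹ l))))
            (≤-reflexive q≡))) (arith q (y s) k b m))
        (<⇒≱ {position y s + position y s} {suc q} (s≤s (≤-reflexive e)))
        where
        arith : ∀ q y k b m → suc q + (suc (y + y) + (k + k + (b + m * 2))) ≡ y + k + (y + k) +
            (b + (m * 1 + m * 1 + (q + 2)))
        arith = solve-∀
      ... | tri≈ _ eb _ = eb , λ u u≢j s<u yu≡ys →
        let
          u≢s : u ≢ s
          u≢s = λ { refl → <-irrefl refl s<u }
          b≰ = <⇒≱ (≤-reflexive (trans (cong (λ z → suc (suc (z + y s))) yu≡ys) eb))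
          nil : K (before y) u s ≡ 0
          nil = trans (K-other (before y) u≢j u≢s)
            (cong₂ _+_ (ind-no (lex? y u s) (λ l → lex-irrefl y (lex-trans y l (inj₂ (sym yu≡ys , s<u)))))
                (ind-no (b ≤? suc (y u + y s)) b≰))
          k<m : suc k ≤ m * 1
          k<m = subst (suc k ≤_) (sum-const m 1) (sum-mono-< (λ v →
            K-elim (before y) (_≤ 1) v s ≤-refl λ v≢j v≢s →
            ind-exclusive (lex? y v s) (b ≤? suc (y v + y s)) (λ l → <⇒≱ (below (≤-reflexive eb) v v≢j l))) u
                (≤-reflexive (cong suc nil)))
        in <⇒≱ {position y s + position y s} {q}
             (balance-≤ (+-mono-≤ (≤-reflexive eb) (+-mono-≤ (+-mono-≤ k<m (<⇒≤ k<m)) (≤-reflexive (sym q≡))))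
                 (arith q (y s) k b m))
             (≤-reflexive (sym e))
        where
        arith : ∀ q y k b m → suc (y + k + (y + k)) + (b + (m * 1 + m * 1 + (q + 2))) ≡ q +
            (suc (suc (y + y)) + (suc k + k + (b + m * 2)))
        arith = solve-∀

  -- Configurations, choices, and the map from choices to configurations

  -- The conditions on a point apart from 2x_i ∉ {0, 1}; since all coordinates lie in [2 , q),
  -- the congruences modulo q become these equations between natural numbers.
  record Config (x : Fin m → ℕ) : Set where
    field
      2≤x       : ∀ s → 2 ≤ x s
      x<q       : ∀ s → x s < q
      tied      : x j ≡ x i
      distinct  : ∀ {s t} → s ≢ j → t ≢ j → s ≢ t → x s ≢ x t
      sum≢q     : ∀ {s t} → s ≢ j → t ≢ j → s ≢ t → x s + x t ≢ q
      sum≢1+q   : ∀ {s t} → s ≢ j → t ≢ j → s ≢ t → x s + x t ≢ suc q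
      ascending : ∀ {s t} → s ≢ j → t ≢ j → x s ≡ suc (x t) → hi t < toℕ s

  -- `avoid` reflects the ascending order inside a run: a label between `i` and `j` with the value
  -- of `i` would have to sit above `i` and below `j`, which share one place.
  record Choice (y : Fin m → ℕ) : Set where
    field
      y<b   : ∀ s → y s < b
      tied  : y j ≡ y i
      avoid : ∀ {t} → toℕ i < toℕ t → toℕ t < toℕ j → y t ≢ y i

  ρ : Fin m → Fin m
  ρ s = if does (s ≟ j) then i else s

  ρ-live : ∀ s → ρ s ≢ j
  ρ-live s with s ≟ j
  ... | yes _  = i≢j
  ... | no s≢j = s≢j

  ρ-id : ∀ {s} → s ≢ j → ρ s ≡ s
  ρ-id {s} s≢j rewrite dec-false (s ≟ j) s≢j = refl

  ρ-j : ρ j ≡ i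
  ρ-j rewrite dec-true (j ≟ j) refl = refl

  ρ-tied : ∀ {A : Set} {f : Fin m → A} → f j ≡ f i → ∀ s → f (ρ s) ≡ f s
  ρ-tied e s with s ≟ j
  ... | yes refl = sym e
  ... | no _     = refl

  G : (Fin m → ℕ) → Fin m → ℕ
  G y s = position y (ρ s)

  G-live : ∀ y {s} → s ≢ j → G y s ≡ position y s
  G-live y s≢j = cong (position y) (ρ-id s≢j)

  K-cong : ∀ {A B : Fin m → Fin m → ℕ} {s} → (∀ {u} → u ≢ j → u ≢ s → A u s ≡ B u s) → ∀ u → K A u s ≡ K B u s
  K-cong {s = s} h u with u ≟ j
  ... | yes _ = refl
  ... | no u≢j with u ≟ s
  ...   | yes _ = refl
  ...   | no u≢s = h u≢j u≢s

  G-resp : ∀ {y y′} → (∀ s → y s ≡ y′ s) → ∀ s → G y s ≡ G y′ s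
  G-resp {y} {y′} e s = cong₂ _+_ (e (ρ s)) (sum-cong-≗
      (K-cong {before y} {before y′} λ {u} _ _ → before-resp u (ρ s)))
    where
    before-resp : ∀ u t → before y u t ≡ before y′ u t
    before-resp u t rewrite e u | e t = refl

  module _ {y} (C : Choice y) where
    open Choice C

    private
      y<b′ : ∀ s → y (ρ s) < b
      y<b′ s = subst (_< b) (sym (ρ-tied {f = y} tied s)) (y<b s)

      sum-split : ∀ {s t} → s ≢ j → t ≢ j → s ≢ t →
        suc (suc q) ≤ position y s + position y t ⊎ position y s + position y t < q
      sum-split {s} {t} s≢j t≢j s≢t with b ≤? suc (y s + y t)
      ... | yes h = inj₁ (position-sum-large y s≢j t≢j s≢t h)
      ... | no h  = inj₂ (position-sum-small y s≢j t≢j s≢t (≰⇒> h))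

      distinct : ∀ {s t} → s ≢ j → t ≢ j → s ≢ t → position y s ≢ position y t
      distinct s≢j t≢j s≢t e with lex-total y s≢t
      ... | inj₁ l = <-irrefl e (position-mono y t≢j s≢j l)
      ... | inj₂ l = <-irrefl (sym e) (position-mono y s≢j t≢j l)

      -- By `ΣK-mono` the sum already absorbs the whole increase by 1, which leaves none for the
      -- value.
      tie : ∀ {s t} → s ≢ j → t ≢ j → Lex y t s → position y s ≡ suc (position y t) → y s ≤ y t
      tie {s} {t} s≢j t≢j l e = balance-≤ (+-mono-≤ (≤-reflexive e) (ΣK-mono y s≢j t≢j l))
          (arith (y s) (y t) (ΣK y s) (ΣK y t))
        where
        arith : ∀ ys yt ks kt → ys + (suc (yt + kt) + ks) ≡ yt + (ys + ks + suc kt)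
        arith = solve-∀

      ascending : ∀ {s t} → s ≢ j → t ≢ j → position y s ≡ suc (position y t) → hi t < toℕ s
      ascending {s} {t} s≢j t≢j e with lex-total y {s} {t} (λ { refl → 1+n≢n (sym e) })
      ... | inj₁ l = contradiction (position-mono y t≢j s≢j l) (<⇒≯ (≤-reflexive (sym e)))
      ... | inj₂ (inj₁ l) = contradiction (tie s≢j t≢j (inj₁ l) e) (<⇒≱ l)
      ... | inj₂ (inj₂ (yt≡ys , t<s)) with t ≟ i
      ...   | no _  = t<s
      -- For `t` equal to `i`, a tied label after `i` cannot come before `j` because of `avoid`;
      -- being different from `j`, it comes after `j`, as `hi` demands.
      ...   | yes refl with <-cmp (toℕ s) (toℕ j)
      ...     | tri< s<j _ _ = contradiction (sym yt≡ys) (avoid t<s s<j)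
      ...     | tri≈ _ s≡j _ = contradiction (FinP.toℕ-injective s≡j) s≢j
      ...     | tri> _ _ j<s = j<s

    G-config : Config (G y)
    G-config = record
      { 2≤x       = λ s → 2≤position y (ρ-live s)
      ; x<q       = λ s → position<q y (ρ-live s) (y<b′ s)
      ; tied      = cong (position y) (trans ρ-j (sym (ρ-id i≢j)))
      ; distinct  = λ s≢j t≢j s≢t → subst₂ _≢_ (sym (G-live y s≢j)) (sym (G-live y t≢j)) (distinct s≢j t≢j s≢t)
      ; sum≢q     = λ s≢j t≢j s≢t → subst₂ (λ k l → k + l ≢ q) (sym (G-live y s≢j)) (sym (G-live y t≢j))
          λ e → [ (λ h → <-irrefl (sym e) (<-trans (n<1+n q) h)) , <-irrefl e ]′ (sum-split s≢j t≢j s≢t)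
      ; sum≢1+q   = λ s≢j t≢j s≢t → subst₂ (λ k l → k + l ≢ suc q) (sym (G-live y s≢j)) (sym (G-live y t≢j))
          λ e → [ <-irrefl (sym e) , (λ h → <-irrefl e (m<n⇒m<1+n h)) ]′ (sum-split s≢j t≢j s≢t)
      ; ascending = λ {s} {t} s≢j t≢j → subst₂ (λ k l → k ≡ suc l → hi t < toℕ s) (sym (G-live y s≢j))
          (sym (G-live y t≢j)) (ascending s≢j t≢j)
      }

  beforeX : (Fin m → ℕ) → Fin m → Fin m → ℕ
  beforeX x u s = ind (x u <? x s) + ind (q <? x u + x s)

  -- Positions preserve the order, and their sums leave a gap at `q` and `q + 1`, so both summands
  -- of `before` can be read off the positions. Equal positions therefore have equal `ΣK`, and
  -- cancelling it makes `G` injective.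
  before-G : ∀ y {s} → s ≢ j → ∀ {u} → u ≢ j → u ≢ s → before y u s ≡ beforeX (G y) u s
  before-G y {s} s≢j {u} u≢j u≢s rewrite G-live y s≢j | G-live y u≢j = cong₂ _+_
    (ind-cong (lex? y u s) (position y u <? position y s) (position-mono y s≢j u≢j)
      λ l → [ id , (λ l′ → contradiction (position-mono y u≢j s≢j l′) (<⇒≯ l)) ]′ (lex-total y u≢s))
    (ind-cong (b ≤? suc (y u + y s)) (q <? position y u + position y s)
      (λ h → <-trans (n<1+n q) (position-sum-large y u≢j s≢j u≢s h))
      λ l → ≮⇒≥ λ h → <-asym l (position-sum-small y u≢j s≢j u≢s h))

  G-injective : ∀ {y y′} → Choice y → Choice y′ → (∀ s → G y s ≡ G y′ s) → ∀ s → y s ≡ y′ s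
  G-injective {y} {y′} C C′ e s =
    trans (sym (ρ-tied {f = y} (Choice.tied C) s)) (trans live (ρ-tied {f = y′} (Choice.tied C′) s))
    where
    r≢j = ρ-live s
    sums : ΣK y (ρ s) ≡ ΣK y′ (ρ s)
    sums = sum-cong-≗ (K-cong {before y} {before y′} λ {u} u≢j u≢s →
      trans (before-G y r≢j u≢j u≢s) (trans
        (cong₂ (λ a c → ind (a <? c) + ind (q <? a + c)) (e u) (e (ρ s)))
        (sym (before-G y′ r≢j u≢j u≢s))))
    live : y (ρ s) ≡ y′ (ρ s)
    live = +-cancelʳ-≡ (ΣK y (ρ s)) _ _ (trans (e s) (cong (λ z → y′ (ρ s) + z) (sym sums)))

  -- The inverse map: counting the empty residues

  module Empties {x : Fin m → ℕ} (X : Config x) where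
    open Config X

    -- ψ v is the number of residues below v that are neither x_u nor −x_u for a label u, where the middle of
    -- [0 , q] counts for one more (ΔT); this makes ψ monotone even if x_u = −x_u occupies the residue q/2 twice.
    κ o : Fin m → ℕ → ℕ
    κ u v = if does (u ≟ j) then 1 else ind (x u <? v) + ind (q <? x u + v)
    o u v = if does (u ≟ j) then 0 else ind (x u ℕ.≟ v) + ind (q ℕ.≟ x u + v)

    N occ T ΔT vacancy ψ : ℕ → ℕ
    N v       = sum (λ u → κ u v)
    occ v     = sum (λ u → o u v)
    T v       = ind (q <? v + v)
    ΔT v      = ind (q ℕ.≟ v + v) + ind (q ℕ.≟ suc (v + v))
    vacancy v = suc (ΔT v) ∸ occ v
    ψ zero    = 0
    ψ (suc v) = ψ v + vacancy v

    T-suc : ∀ v → T (suc v) ≡ T v + ΔT v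
    T-suc v rewrite +-suc v v | ind-<-suc q (suc (v + v)) | ind-<-suc q (v + v) =
      +-assoc (ind (q <? v + v)) _ _

    κ-suc : ∀ u v → κ u (suc v) ≡ κ u v + o u v
    κ-suc u v with u ≟ j
    ... | yes _ = refl
    ... | no _ rewrite +-suc (x u) v | ind-<-suc (x u) v | ind-<-suc q (x u + v) =
      exchange (ind (x u <? v)) (ind (x u ℕ.≟ v)) (ind (q <? x u + v)) (ind (q ℕ.≟ x u + v))
      where
      exchange : ∀ a c d e → a + c + (d + e) ≡ a + d + (c + e)
      exchange = solve-∀

    N-suc : ∀ v → N (suc v) ≡ N v + occ v
    N-suc v = trans (sum-cong-≗ (λ u → κ-suc u v)) (∑-distrib-+ (λ u → κ u v) (λ u → o u v))

    Occupies : Fin m → ℕ → Set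
    Occupies u v = x u ≡ v ⊎ q ≡ x u + v

    occupies? : ∀ u v → Dec (Occupies u v)
    occupies? u v = (x u ℕ.≟ v) ⊎-dec (q ℕ.≟ x u + v)

    occupier-unique : ∀ {u w v} → u ≢ j → w ≢ j → Occupies u v → Occupies w v → u ≡ w
    occupier-unique {u} {w} {v} u≢j w≢j p p′ with u ≟ w
    ... | yes u≡w = u≡w
    ... | no u≢w  = ⊥-elim (clash p p′)
      where
      clash : Occupies u v → Occupies w v → ⊥
      clash (inj₁ e) (inj₁ e′) = distinct u≢j w≢j u≢w (trans e (sym e′))
      clash (inj₁ e) (inj₂ e′) = sum≢q u≢j w≢j u≢w (trans (cong (_+ x w) e) (trans (+-comm v (x w)) (sym e′)))
      clash (inj₂ e) (inj₁ e′) = sum≢q u≢j w≢j u≢w (trans (cong (λ z → x u + z) e′) (sym e))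
      clash (inj₂ e) (inj₂ e′) = distinct u≢j w≢j u≢w (+-cancelʳ-≡ v _ _ (trans (sym e) e′))

    o-vacant : ∀ {u v} → (u ≢ j → ¬ Occupies u v) → o u v ≡ 0
    o-vacant {u} {v} f with u ≟ j
    ... | yes _ = refl
    ... | no u≢j = cong₂ _+_ (ind-no (x u ℕ.≟ v) (f u≢j ∘ inj₁)) (ind-no (q ℕ.≟ x u + v) (f u≢j ∘ inj₂))

    o-live : ∀ {u} v → u ≢ j → o u v ≡ ind (x u ℕ.≟ v) + ind (q ℕ.≟ x u + v)
    o-live {u} v u≢j rewrite dec-false (u ≟ j) u≢j = refl

    data Occupation (v : ℕ) : Set where
      vacant   : occ v ≡ 0 → Occupation v
      occupied : ∀ w → w ≢ j → Occupies w v → occ v ≡ ind (x w ℕ.≟ v) + ind (q ℕ.≟ x w + v) → Occupation v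

    occupation : ∀ v → Occupation v
    occupation v with FinP.any? (λ u → ¬? (u ≟ j) ×-dec occupies? u v)
    ... | no none = vacant (trans (sum-cong-≗ (λ u → o-vacant λ u≢j p → none (u , u≢j , p)))
                                  (trans (sum-const m 0) (*-zeroʳ m)))
    ... | yes (w , w≢j , p) = occupied w w≢j p (begin
      occ v                              ≡⟨ +-identityʳ _ ⟨
      occ v + 0                          ≡⟨ sum-swap-at {g = λ _ → 0} w
          (λ u u≢w → o-vacant λ u≢j p′ → u≢w (occupier-unique u≢j w≢j p′ p)) ⟩
      sum {m} (λ _ → 0) + o w v          ≡⟨ cong (_+ o w v) (trans (sum-const m 0) (*-zeroʳ m)) ⟩
      o w v                              ≡⟨ o-live v w≢j ⟩
      ind (x w ℕ.≟ v) + ind (q ℕ.≟ x w + v) ∎)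
      where open ≡-Reasoning

    -- The truncated subtraction in `vacancy` loses nothing: only one label can occupy a residue,
    -- and it does so twice only if q = 2v, where `ΔT` is 1.
    occ≤ : ∀ v → occ v ≤ suc (ΔT v)
    occ≤ v with occupation v
    ... | vacant e = ≤-trans (≤-reflexive e) z≤n
    ... | occupied w _ _ e = ≤-trans (≤-reflexive e) (bound (x w ℕ.≟ v))
      where
      bound : Dec (x w ≡ v) → ind (x w ℕ.≟ v) + ind (q ℕ.≟ x w + v) ≤ suc (ΔT v)
      bound (yes xw≡v) = +-mono-≤ (ind≤1 (x w ℕ.≟ v))
        (≤-trans (ind-mono (q ℕ.≟ x w + v) (q ℕ.≟ v + v) (λ e′ → trans e′ (cong (_+ v) xw≡v))) (m≤m+n _ _))
      bound (no xw≢v)  = ≤-trans (+-mono-≤ (≤-reflexive (ind-no (x w ℕ.≟ v) xw≢v)) (ind≤1 (q ℕ.≟ x w + v)))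
          (s≤s z≤n)

    -- The side condition comes from the second summand of `ΔT`, which keeps the vacancy positive
    -- when q = 2v + 1. `chain` needs it to exclude a run in which a label sits directly above its
    -- own negative, a case that `Config` permits.
    vacancy≡0 : ∀ {v} → vacancy v ≡ 0 → ∃[ w ] w ≢ j × (x w ≡ v ⊎ (q ≡ x w + v × q ≢ suc (v + v)))
    vacancy≡0 {v} vac with m∸n≡0⇒m≤n {suc (ΔT v)} {occ v} vac | occupation v
    ... | le | vacant e = contradiction (≤-trans le (≤-reflexive e)) λ ()
    ... | le | occupied w w≢j p e with p
    ...   | inj₁ xw≡v = w , w≢j , inj₁ xw≡v
    ...   | inj₂ q≡x+v with x w ℕ.≟ v
    ...     | yes xw≡v = w , w≢j , inj₁ xw≡v
    ...     | no xw≢v = w , w≢j , inj₂ (q≡x+v , λ q≡ → <⇒≱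
                (s≤s (≤-trans (≤-reflexive (sym (ind-yes (q ℕ.≟ suc (v + v)) q≡))) (m≤n+m _ _)))
                (≤-trans le (≤-trans (≤-reflexive e)
                  (+-mono-≤ (≤-reflexive (ind-no (x w ℕ.≟ v) xw≢v)) (ind≤1 (q ℕ.≟ x w + v))))))

    N0 : N 0 ≡ 1
    N0 = begin
      N 0                       ≡⟨ +-identityʳ _ ⟨
      N 0 + 0                   ≡⟨ sum-swap-at {g = λ _ → 0} j off-j ⟩
      sum {m} (λ _ → 0) + κ j 0 ≡⟨ cong₂ _+_ (trans (sum-const m 0) (*-zeroʳ m)) κ-j ⟩
      1                         ∎
      where
      open ≡-Reasoning
      κ-j : κ j 0 ≡ 1
      κ-j rewrite dec-true (j ≟ j) refl = refl
      off-j : ∀ u → u ≢ j → κ u 0 ≡ 0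
      off-j u u≢j rewrite dec-false (u ≟ j) u≢j = cong₂ _+_ (ind-no (x u <? 0) λ ())
        (ind-no (q <? x u + 0) (<-asym (subst (_< q) (sym (+-identityʳ (x u))) (x<q u))))

    -- Summing the vacancies: `N` collects the occupied residues, `T` the middle correction, and the
    -- final 1 is the constant term of `j` in `N`.
    ψ-N : ∀ v → ψ v + N v ≡ v + T v + 1
    ψ-N zero    rewrite N0 | ind-no (q <? 0) (λ ()) = refl
    ψ-N (suc v) = balance-≡ (cong₂ _+_ (ψ-N v) (cong₂ _+_ (m∸n+n≡m (occ≤ v)) (cong₂ _+_ (N-suc v) (sym (T-suc v)))))
      (arith (ψ v) (vacancy v) (N (suc v)) v (T v) (N v) (occ v) (ΔT v) (T (suc v)))
      where
      arith : ∀ p e n v t n′ o d t′ → p + e + n + (v + t + 1 + (suc d + (n′ + o + t′))) ≡ suc (v + t′ + 1) +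
          (p + n′ + (e + o + (n + (t + d))))
      arith = solve-∀

    ψ-mono : ∀ {v w} → v ≤ w → ψ v ≤ ψ w
    ψ-mono {v} {w} v≤w = subst (λ w → ψ v ≤ ψ w) (m+[n∸m]≡n v≤w) (go (w ∸ v))
      where
      go : ∀ l → ψ v ≤ ψ (v + l)
      go zero    = ≤-reflexive (cong ψ (sym (+-identityʳ v)))
      go (suc l) = ≤-trans (go l) (subst (λ w → ψ (v + l) ≤ ψ w) (sym (+-suc v l)) (m≤m+n _ _))

    -- Where ψ is constant every cell is occupied; going down from x s, a cell cannot be occupied by a
    -- negated label, because x w + x u = q + 1 is excluded.
    chain : ∀ {s} → s ≢ j → ∀ l {v} → v + l ≡ x s → ψ v ≡ ψ (x s) → ∃[ u ] u ≢ j × x u ≡ v × (u ≡ s ⊎ hi u < toℕ s)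
    chain {s} s≢j zero    {v} e _  = s , s≢j , trans (sym e) (+-identityʳ v) , inj₁ refl
    chain {s} s≢j (suc l) {v} e eψ with chain s≢j l {suc v} (trans (sym (+-suc v l)) e) ψ-suc
      where
      ψ-suc : ψ (suc v) ≡ ψ (x s)
      ψ-suc = ≤-antisym (ψ-mono (≤-trans (m≤m+n (suc v) l) (≤-reflexive (trans (sym (+-suc v l)) e))))
                        (≤-trans (≤-reflexive (sym eψ)) (m≤m+n _ _))
    ... | u , u≢j , xu≡ , u≼s with vacancy≡0 {v} (m+n≡m⇒n≡0 (ψ v) (≤-antisym
            (≤-trans (ψ-mono (≤-trans (m≤m+n (suc v) l) (≤-reflexive (trans (sym (+-suc v l)) e))))
                (≤-reflexive (sym eψ))) (m≤m+n _ _)))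
      where
      m+n≡m⇒n≡0 : ∀ a {c} → a + c ≡ a → c ≡ 0
      m+n≡m⇒n≡0 a {c} p = +-cancelˡ-≡ a c 0 (trans p (sym (+-identityʳ a)))
    ...   | w , w≢j , inj₁ xw≡v = w , w≢j , xw≡v , inj₂
            ([ (λ { refl → w<u }) , (λ hiu<s → <-trans w<u (≤-<-trans (≤hi u) hiu<s)) ]′ u≼s)
      where
      w<u : hi w < toℕ u
      w<u = ascending u≢j w≢j (trans xu≡ (cong suc (sym xw≡v)))
    ...   | w , w≢j , inj₂ (q≡x+v , q≢) with w ≟ u
    ...     | yes refl = contradiction (trans q≡x+v (cong (_+ v) xu≡)) q≢
    ...     | no w≢u = contradiction (trans (cong (λ z → x w + z) xu≡)
        (trans (+-suc (x w) v) (cong suc (sym q≡x+v)))) (sum≢1+q w≢j u≢j w≢u)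

    chain-from : ∀ {s} → s ≢ j → ∀ {v} → v ≤ x s → (∀ u → u ≢ j → x u ≡ v → (u ≡ s ⊎ hi u < toℕ s) → ⊥) → ψ v <
        ψ (x s)
    chain-from {s} s≢j {v} v≤ f = ≤∧≢⇒< (ψ-mono v≤) λ e →
      let (u , u≢j , xu≡v , p) = chain s≢j (x s ∸ v) (m+[n∸m]≡n v≤) e in f u u≢j xu≡v p

    ψ1≥1 : 1 ≤ ψ 1
    ψ1≥1 = n≢0⇒n>0 λ e → absurd (vacancy≡0 {0} e)
      where
      absurd : (∃[ w ] w ≢ j × (x w ≡ 0 ⊎ (q ≡ x w + 0 × q ≢ 1))) → ⊥
      absurd (w , _ , inj₁ e)       = <⇒≢ (<-≤-trans (s≤s z≤n) (2≤x w)) (sym e)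
      absurd (w , _ , inj₂ (e , _)) = <⇒≢ (x<q w) (sym (trans e (+-identityʳ (x w))))

    -- `ψ` grows at 0, which is never occupied, and again between 1 and x_s, since an unbroken run
    -- would put a label at 1. These two units are the shift by 2 in `y`.
    2≤ψ : ∀ s → s ≢ j → 2 ≤ ψ (x s)
    2≤ψ s s≢j = ≤-<-trans ψ1≥1 (chain-from s≢j (<⇒≤ (2≤x s)) λ u _ e _ → <⇒≢ (2≤x u) (sym e))

    -- For every label exactly one of x_u < v and q - x_u < v′ holds, so the two values of `N` add
    -- up to 2m; the rest is `ψ-N` at both points.
    ψ-symmetric : ∀ {v v′} → v + v′ ≡ suc q → ψ v + ψ v′ ≡ b + 1 + (T v + T v′)
    ψ-symmetric {v} {v′} e = balance-≡ (cong₂ _+_ (ψ-N v)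
        (cong₂ _+_ (ψ-N v′) (cong₂ _+_ (sym NN) (cong₂ _+_ e q≡))))
      (arith (ψ v) (ψ v′) (N v) (N v′) v v′ (T v) (T v′) (m * 2) q b)
      where
      complement : ∀ a w w′ → w + w′ ≡ suc q → ind (a <? w) + ind (q <? a + w′) ≡ 1
      complement a w w′ e = ≤-antisym
        (ind-exclusive (a <? w) (q <? a + w′) λ a<w q<a+w′ → <-irrefl refl
            (<-≤-trans (≤-<-trans q<a+w′ (+-monoˡ-< w′ a<w)) (≤-reflexive e)))
        (ind-exhaustive (a <? w) (q <? a + w′) λ a≮w → ≤-trans (≤-reflexive (sym e)) (+-monoˡ-≤ w′ (≮⇒≥ a≮w)))
      exchange : ∀ a c d e → a + c + (d + e) ≡ (a + e) + (d + c)
      exchange = solve-∀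
      pointwise : ∀ u → κ u v + κ u v′ ≡ 2
      pointwise u with u ≟ j
      ... | yes _ = refl
      ... | no _  = trans (exchange (ind (x u <? v)) (ind (q <? x u + v)) (ind (x u <? v′)) (ind (q <? x u + v′)))
        (cong₂ _+_ (complement (x u) v v′ e) (complement (x u) v′ v (trans (+-comm v′ v) e)))
      NN : N v + N v′ ≡ m * 2
      NN = trans (sym (∑-distrib-+ (λ u → κ u v) (λ u → κ u v′))) (trans (sum-cong-≗ pointwise) (sum-const m 2))
      arith : ∀ p p′ n n′ v v′ t t′ m q b → p + p′ + (v + t + 1 + (v′ + t′ + 1 + (n + n′ + (suc q + (b + m)))))
            ≡ b + 1 + (t + t′) + (p + n + (p′ + n′ + (m + (v + v′ + (q + 2)))))
      arith = solve-∀

    y : Fin m → ℕ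
    y s = ψ (x s) ∸ 2

    y+2 : ∀ {s} → s ≢ j → y s + 2 ≡ ψ (x s)
    y+2 s≢j = m∸n+n≡m (2≤ψ _ s≢j)

    -- Equal values mean an unbroken run from x_t up to x_s, and by distinctness the label that
    -- `chain` finds at its foot is `t` itself.
    y-order : ∀ {t s} → t ≢ j → s ≢ j → x t < x s → y t < y s ⊎ (y t ≡ y s × hi t < toℕ s)
    y-order {t} {s} t≢j s≢j l with m≤n⇒m<n∨m≡n (ψ-mono (<⇒≤ l))
    ... | inj₁ l′ = inj₁ (∸-monoˡ-< l′ (2≤ψ t t≢j))
    ... | inj₂ e with chain s≢j (x s ∸ x t) (m+[n∸m]≡n (<⇒≤ l)) e
    ...   | u , u≢j , xu≡xt , p with u ≟ t
    ...     | no u≢t = contradiction xu≡xt (distinct u≢j t≢j u≢t)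
    ...     | yes refl with p
    ...       | inj₁ refl = contradiction l (<-irrefl refl)
    ...       | inj₂ h    = inj₂ (cong (_∸ 2) e , h)

    y-lex : ∀ {t s} → t ≢ j → s ≢ j → x t < x s → Lex y t s
    y-lex {t} t≢j s≢j l with y-order t≢j s≢j l
    ... | inj₁ l′ = inj₁ l′
    ... | inj₂ (e , h) = inj₂ (e , ≤-<-trans (≤hi t) h)

    -- Reflection takes x_s to `v′`, which is at most x_t. No run joins `v′` to x_t, since a label
    -- at `v′` would add up with x_s to `q + 1`; and one of the two reflected points is past the
    -- middle. So ψ(x_t) + ψ(x_s) ≥ b + 3, of which `y` drops 4.
    y-sum-large : ∀ {t s} → t ≢ j → s ≢ j → x t < x s → q < x t + x s → b ≤ suc (y t + y s)
    y-sum-large {t} {s} t≢j s≢j t<s h = balance-≤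
      (+-mono-≤ strict (+-mono-≤ (≤-reflexive (sym sym-ψ))
          (+-mono-≤ (≤-reflexive (sym (y+2 t≢j))) (+-mono-≤ (≤-reflexive (sym (y+2 s≢j))) TT))))
      (arith b (y t) (y s) (ψ (x s)) (ψ v′) (ψ (x t)) (T (x s) + T v′))
      where
      v′ = suc q ∸ x s
      v+v′ : x s + v′ ≡ suc q
      v+v′ = m+[n∸m]≡n (<⇒≤ (m<n⇒m<1+n (x<q s)))
      sym-ψ = ψ-symmetric {x s} {v′} v+v′
      v′≤ : v′ ≤ x t
      v′≤ = ≤-trans (∸-monoˡ-≤ (x s) h) (≤-reflexive (m+n∸n≡m (x t) (x s)))
      strict : ψ v′ < ψ (x t)
      strict = chain-from t≢j v′≤ λ u u≢j xu≡v′ p →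
        let e = trans (cong (λ z → x s + z) xu≡v′) v+v′ in
        sum≢1+q s≢j u≢j (λ { refl → [ (λ { refl → <-irrefl refl t<s })
           , (λ _ → <⇒≱ t<s (≤-trans (≤-reflexive xu≡v′) v′≤)) ]′ p }) e
      TT : 1 ≤ T (x s) + T v′
      TT = ind-exhaustive (q <? x s + x s) (q <? v′ + v′) λ ¬l →
        balance-≤ (+-mono-≤ (≮⇒≥ ¬l) (≤-trans (n≤1+n _) (≤-reflexive (cong₂ _+_ (sym v+v′) (sym v+v′)))))
            (arith′ q (x s) v′)
        where
        arith′ : ∀ q v v′ → suc q + (q + (v + v′ + (v + v′))) ≡ v′ + v′ + (v + v + (q + suc q))
        arith′ = solve-∀
      arith : ∀ b yt ys ps p′ pt tt → b + (pt + (ps + p′ + (yt + 2 + (ys + 2 + tt)))) ≡ suc (yt + ys) +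
          (suc p′ + (b + 1 + tt + (pt + (ps + 1))))
      arith = solve-∀

    -- Reflecting x_t + 1 rather than x_t gives q - x_t, which is still at least x_s, while 2(x_t +
    -- 1) ≤ q makes one correction vanish. So ψ(x_t) + ψ(x_s) ≤ b + 2.
    y-sum-small : ∀ {t s} → t ≢ j → s ≢ j → x t < x s → x t + x s < q → suc (y t + y s) < b
    y-sum-small {t} {s} t≢j s≢j t<s h = balance-≤
      (+-mono-≤ (ψ-mono (n≤1+n (x t))) (+-mono-≤ (ψ-mono v′≥)
          (+-mono-≤ (≤-reflexive sym-ψ) (+-mono-≤ (≤-reflexive (y+2 t≢j)) (+-mono-≤ (≤-reflexive (y+2 s≢j)) TT)))))
      (arith b (y t) (y s) (ψ (x s)) (ψ v) (ψ v′) (ψ (x t)) (T v + T v′))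
      where
      v  = suc (x t)
      v′ = suc q ∸ v
      v+v′ : v + v′ ≡ suc q
      v+v′ = m+[n∸m]≡n (m<n⇒m<1+n (x<q t))
      sym-ψ = ψ-symmetric {v} {v′} v+v′
      v′≥ : x s ≤ v′
      v′≥ = ≤-trans (≤-reflexive (sym (m+n∸m≡n (x t) (x s)))) (∸-monoˡ-≤ (x t) (<⇒≤ h))
      TT : T v + T v′ ≤ 1
      TT = +-mono-≤ (≤-reflexive (ind-no (q <? v + v) (<⇒≱ (s≤s (≤-trans (s≤s (+-monoʳ-≤ (x t) t<s)) h)))))
          (ind≤1 (q <? v′ + v′))
      arith : ∀ b yt ys ps p p′ pt tt → suc (suc (yt + ys)) + (p + (p′ + (b + 1 + tt + (pt + (ps + 1))))) ≡ b +
          (pt + (ps + (p + p′ + (yt + 2 + (ys + 2 + tt)))))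
      arith = solve-∀

    -- Reflection exchanges `q` and 1, so ψ(q) + ψ(1) ≤ b + 2, while ψ(1) ≥ 1.
    y<b : ∀ {s} → s ≢ j → y s < b
    y<b {s} s≢j = balance-≤
      (+-mono-≤ (ψ-mono (<⇒≤ (x<q s))) (+-mono-≤ ψ1≥1
          (+-mono-≤ (≤-reflexive (ψ-symmetric {q} {1} (+-comm q 1))) (+-mono-≤ (≤-reflexive (y+2 s≢j)) TT))))
      (arith b (y s) (ψ (x s)) (ψ q) (ψ 1) (T q + T 1))
      where
      TT : T q + T 1 ≤ 1
      TT = +-mono-≤ (ind≤1 (q <? q + q)) (≤-reflexive (ind-no (q <? 2) (<⇒≯ (≤-<-trans (2≤x s) (x<q s)))))
      arith : ∀ b y ps pq p1 tt → suc y + (pq + (p1 + (b + 1 + tt + (ps + 1)))) ≡ b +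
          (ps + (1 + (pq + p1 + (y + 2 + tt))))
      arith = solve-∀

    before-y : ∀ {s} → s ≢ j → ∀ {u} → u ≢ j → u ≢ s → before y u s ≡ beforeX x u s
    before-y {s} s≢j {u} u≢j u≢s = cong₂ _+_
      (ind-cong (lex? y u s) (x u <? x s)
        (λ l → [ id , (λ l′ → contradiction (lex-trans y l (y-lex s≢j u≢j l′)) (lex-irrefl y)) ]′ order)
        (y-lex u≢j s≢j))
      (ind-cong (b ≤? suc (y u + y s)) (q <? x u + x s)
        (λ h → [ (λ l → contradiction h (<⇒≱ (small l))) , id ]′ cases)
        large)
      where
      order : x u < x s ⊎ x s < x u
      order = ≢⇒<⊎> (distinct u≢j s≢j u≢s)
        where
        ≢⇒<⊎> : ∀ {a c} → a ≢ c → a < c ⊎ c < a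
        ≢⇒<⊎> {a} {c} ne with <-cmp a c
        ... | tri< l _ _ = inj₁ l
        ... | tri≈ _ e _ = contradiction e ne
        ... | tri> _ _ l = inj₂ l
      cases : x u + x s < q ⊎ q < x u + x s
      cases with <-cmp (x u + x s) q
      ... | tri< l _ _ = inj₁ l
      ... | tri≈ _ e _ = contradiction e (sum≢q u≢j s≢j u≢s)
      ... | tri> _ _ l = inj₂ l
      large : q < x u + x s → b ≤ suc (y u + y s)
      large h = [ (λ l → y-sum-large u≢j s≢j l h)
                , (λ l → subst (λ k → b ≤ suc k) (+-comm (y s) (y u))
                    (y-sum-large s≢j u≢j l (subst (q <_) (+-comm (x u) (x s)) h))) ]′ order
      small : x u + x s < q → suc (y u + y s) < b
      small h = [ (λ l → y-sum-small u≢j s≢j l h)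
                , (λ l → subst (λ k → suc k < b) (+-comm (y s) (y u))
                    (y-sum-small s≢j u≢j l (subst (_< q) (+-comm (x u) (x s)) h))) ]′ order

    ΣKx : Fin m → ℕ
    ΣKx s = sum (λ u → K (beforeX x) u s)

    -- In `N` the term of `s` is `T (x s)`, because -s lies below `s` exactly past the middle. `K`
    -- has 1 in its place, so the correction built into `ψ` cancels.
    ψ-ΣKx : ∀ {s} → s ≢ j → ψ (x s) + ΣKx s ≡ x s + 2
    ψ-ΣKx {s} s≢j = balance-≡ (cong₂ _+_ swap (ψ-N (x s)))
      (arith (ψ (x s)) (ΣKx s) (x s) (N (x s)) (T (x s)))
      where
      κ-s : κ s (x s) ≡ T (x s)
      κ-s rewrite dec-false (s ≟ j) s≢j = cong (_+ T (x s)) (ind-no (x s <? x s) (<-irrefl refl))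
      off-s : ∀ u → u ≢ s → K (beforeX x) u s ≡ κ u (x s)
      off-s u u≢s rewrite dec-false (u ≟ s) u≢s = refl
      swap : ΣKx s + T (x s) ≡ N (x s) + 1
      swap = subst₂ (λ a c → ΣKx s + a ≡ N (x s) + c) κ-s (K-self (beforeX x) s≢j)
          (sum-swap-at {g = λ u → κ u (x s)} s off-s)
      arith : ∀ p k v n t → p + k + (n + 1 + (v + t + 1)) ≡ v + 2 + (k + t + (p + n))
      arith = solve-∀

    position-y : ∀ {s} → s ≢ j → position y s ≡ x s
    position-y {s} s≢j = balance-≡
      (cong₂ _+_ (sum-cong-≗ (K-cong {before y} {beforeX x} (before-y s≢j))) (cong₂ _+_ (ψ-ΣKx s≢j) (y+2 s≢j)))
      (arith (y s) (ΣK y s) (x s) (ΣKx s) (ψ (x s)))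
      where
      arith : ∀ y k v k′ p → y + k + (k′ + (v + 2 + p)) ≡ v + (k + (p + k′ + (y + 2)))
      arith = solve-∀

    G-y : ∀ s → G y s ≡ x s
    G-y s = trans (position-y (ρ-live s)) (ρ-tied {f = x} tied s)

    y-choice : Choice y
    y-choice = record
      { y<b   = λ s → subst (_< b) (ρ-tied {f = y} y-tied s) (y<b (ρ-live s))
      ; tied  = y-tied
      ; avoid = avoid
      }
      where
      y-tied : y j ≡ y i
      y-tied = cong (λ v → ψ v ∸ 2) tied
      avoid : ∀ {t} → toℕ i < toℕ t → toℕ t < toℕ j → y t ≢ y i
      -- A tie would be a run containing both labels. With `t` below `i` its order requires t < i;
      -- with `i` below `t` it requires hi i = j < t.
      avoid {t} i<t t<j e with <-cmp (x t) (x i)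
      ... | tri≈ _ e′ _ = distinct {t} {i} (λ { refl → <-irrefl refl t<j }) i≢j (λ { refl → <-irrefl refl i<t }) e′
      ... | tri< l _ _ with y-order (λ { refl → <-irrefl refl t<j }) i≢j l
      ...   | inj₁ l′      = <-irrefl e l′
      ...   | inj₂ (_ , h) = <-asym i<t (≤-<-trans (≤hi t) h)
      avoid {t} i<t t<j e | tri> _ _ l with y-order i≢j (λ { refl → <-irrefl refl t<j }) l
      ...   | inj₁ l′      = <-irrefl (sym e) l′
      ...   | inj₂ (_ , h) = <-asym t<j (subst (_< toℕ t) hi-i h)

  -- Points lying on `H` only, described as configurations

  H : Hyp m
  H = e i ⊖ e j , + 0

  Middle : ℕ → Set
  Middle v = v + v ≡ q ⊎ v + v ≡ suc q

  OnlyOn : Vec ℕ m → Set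
  OnlyOn x = x ∈[ q ] H × All (λ K → ¬ x ∈[ q ] K) (removeH H (shiB m))

  -- Coordinate `j` tells `H` apart: no coordinate or sum hyperplane has a negative coefficient
  -- there, and a difference has one only if its second label is `j`.
  Hj : lookup (e i ⊖ e j) j ≡ ℤ.- + 1
  Hj = trans (VecP.lookup-zipWith ℤ._-_ j (e i) (e j))
             (cong₂ ℤ._-_ (lookup-e-other (i≢j ∘ sym)) (lookup-e-same j))

  e-nonneg : ∀ s k → ∃[ n ] lookup (e {m} s) k ≡ + n
  e-nonneg s k with k ≟ s
  ... | yes refl = 1 , lookup-e-same k
  ... | no k≢s   = 0 , lookup-e-other k≢s

  H≢coord : ∀ {s c} → H ≢ (e s , c)
  H≢coord {s} eq with e-nonneg s j
  ... | n , en with trans (sym Hj) (trans (cong (λ K → lookup (proj₁ K) j) eq) en)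
  ...   | ()

  H≢plus : ∀ {s t c} → H ≢ (e s ⊕ e t , c)
  H≢plus {s} {t} eq with e-nonneg s j | e-nonneg t j
  ... | n , en | n′ , en′ with trans (sym Hj) (trans (cong (λ K → lookup (proj₁ K) j) eq)
                            (trans (VecP.lookup-zipWith ℤ._+_ j (e s) (e t)) (cong₂ ℤ._+_ en en′)))
  ...   | ()

  H≢minus : ∀ {s t c} → t ≢ j → H ≢ (e s ⊖ e t , c)
  H≢minus {s} {t} t≢j eq with e-nonneg s j
  ... | n , en with trans (sym Hj) (trans (cong (λ K → lookup (proj₁ K) j) eq)
                 (trans (VecP.lookup-zipWith ℤ._-_ j (e s) (e t)) (cong₂ ℤ._-_ en (lookup-e-other (t≢j ∘ sym)))))
  ...   | e′ with trans e′ (ℤP.+-identityʳ (+ n))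
  ...     | ()

  H≢minus₁ : ∀ {s t} → H ≢ (e s ⊖ e t , + 1)
  H≢minus₁ eq with cong proj₂ eq
  ... | ()

  module _ {x : Vec ℕ m} (x<q : ∀ s → lookup x s < q) where
    onlyOn⇒config : OnlyOn x → Config (lookup x) × ¬ Middle (lookup x i)
    onlyOn⇒config (x∈H , all) = record
      { 2≤x = 2≤x
      ; x<q = x<q
      ; tied = tied
      ; distinct = distinct
      ; sum≢q = λ _ _ → sum≢ 0 plus
      ; sum≢1+q = λ _ _ → sum≢ 1 plus₁
      ; ascending = ascending
      } , λ { (inj₁ e)  → off (plus i<j) H≢plus
          (∈-plus⁺ {x = x} {s = i} {j} {0} (trans (cong (λ z → lookup x i + z) tied) e))
            ; (inj₂ e) → off (plus₁ i<j) H≢plus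
                (∈-plus⁺ {x = x} {s = i} {j} {1} (trans (cong (λ z → lookup x i + z) tied) e)) }
      where
      off : ∀ {K} → Shi K → H ≢ K → ¬ x ∈[ q ] K
      off S H≢K = All.lookup all (∈-filter⁺ (λ K → ¬? (H ≟H K)) (∈-shiB⁺ S) H≢K)
      x≢0 : ∀ s → lookup x s ≢ 0
      x≢0 s e = off (coord s) H≢coord (∈-coord⁺ {x = x} {s = s} {c = 0} (congruent-refl e))
      x≢1 : ∀ s → lookup x s ≢ 1
      x≢1 s e = off (coord₁ s) H≢coord (∈-coord⁺ {x = x} {s = s} {c = 1} (congruent-refl e))
      2≤x : ∀ s → 2 ≤ lookup x s
      2≤x s with lookup x s | x≢0 s | x≢1 s
      ... | 0 | ne | _ = contradiction refl ne
      ... | 1 | _ | ne = contradiction refl ne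
      ... | suc (suc _) | _ | _ = s≤s (s≤s z≤n)
      tied : lookup x j ≡ lookup x i
      tied = sym (congruent-near (<-≤-trans (x<q i) (m≤n+m q _)) (<-≤-trans (x<q j) (m≤n+m q _))
                     (subst (λ z → q ∣ ∣ z ∣) (dot-minus {x = x} {q} i j 0) x∈H))
      distinct : ∀ {s t} → s ≢ j → t ≢ j → s ≢ t → lookup x s ≢ lookup x t
      distinct {s} {t} s≢j t≢j s≢t eq with <-cmp (toℕ s) (toℕ t)
      ... | tri< l _ _ = off (minus l) (H≢minus t≢j) (∈-minus⁺ {x = x} {s = s} {t} 0 eq)
      ... | tri≈ _ s≡t _ = s≢t (FinP.toℕ-injective s≡t)
      ... | tri> _ _ l = off (minus l) (H≢minus s≢j) (∈-minus⁺ {x = x} {s = t} {s} 0 (sym eq))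
      sum≢ : ∀ c → (∀ {s t} → toℕ s < toℕ t → Shi (e s ⊕ e t , + c)) →
        ∀ {s t} → s ≢ t → lookup x s + lookup x t ≢ c + q
      sum≢ c S {s} {t} s≢t eq with <-cmp (toℕ s) (toℕ t)
      ... | tri< l _ _ = off (S l) H≢plus (∈-plus⁺ {x = x} {s = s} {t} {c} eq)
      ... | tri≈ _ s≡t _ = s≢t (FinP.toℕ-injective s≡t)
      ... | tri> _ _ l = off (S l) H≢plus (∈-plus⁺ {x = x} {s = t} {s} {c}
          (trans (+-comm (lookup x t) (lookup x s)) eq))
      not-before : ∀ {s t} → lookup x s ≡ suc (lookup x t) → ¬ toℕ s < toℕ t
      not-before {s} {t} eq l = off (minus₁ l) H≢minus₁ (∈-minus⁺ {x = x} {s = s} {t} 1 eq)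
      ascending : ∀ {s t} → s ≢ j → t ≢ j → lookup x s ≡ suc (lookup x t) → hi t < toℕ s
      ascending {s} {t} s≢j t≢j eq with t ≟ i
      -- Since x_j = x_i, the hyperplane of x_s - x_j = 1 is avoided too, so `s` cannot precede `j`;
      -- this is the source of `hi`.
      ... | yes refl = ≤∧≢⇒< (≮⇒≥ (not-before (trans eq (cong suc (sym tied))))) (s≢j ∘ sym ∘ FinP.toℕ-injective)
      ... | no _     = ≤∧≢⇒< (≮⇒≥ (not-before eq)) λ t≡s → 1+n≢n
          (sym (trans (cong (lookup x) (FinP.toℕ-injective t≡s)) eq))

    module _ (X : Config (lookup x)) (¬mid : ¬ Middle (lookup x i)) where
      open Config X using (2≤x; tied; distinct; sum≢q; sum≢1+q; ascending)
      private
        rep : ∀ s → lookup x (ρ s) ≡ lookup x s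
        rep = ρ-tied {f = lookup x} tied

        ρ-collide : ∀ {s t} → toℕ s < toℕ t → ρ s ≡ ρ t → s ≡ i × t ≡ j
        ρ-collide {s} {t} s<t eq with s ≟ j | t ≟ j
        ... | yes refl | yes refl = contradiction s<t (<-irrefl refl)
        ... | yes refl | no _     = contradiction s<t (<-asym (subst (λ k → toℕ k < toℕ j) eq i<j))
        ... | no _     | yes refl = eq , refl
        ... | no _     | no _     = contradiction s<t (<-irrefl (cong toℕ eq))

        sum-bound : ∀ {s t c} → c < 2 → x ∈[ q ] (e s ⊕ e t , + c) → lookup x s + lookup x t ≡ c + q
        sum-bound {s} {t} {c} c<2 x∈ = congruent-above
          (<-≤-trans c<2 (≤-trans (2≤x s) (m≤m+n _ _)))
          (≤-trans (+-mono-<-≤ (x<q s) (<⇒≤ (x<q t)))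
              (≤-trans (m≤n+m (q + q) c) (≤-reflexive (sym (+-assoc c q q)))))
          (subst (λ z → q ∣ ∣ z ℤ.- + c ∣) (dot-plus {x = x} {q} s t) x∈)

        sum-off : ∀ c → (∀ {s t} → s ≢ j → t ≢ j → s ≢ t → lookup x s + lookup x t ≢ c + q) →
          lookup x i + lookup x i ≢ c + q → ∀ {s t} → toℕ s < toℕ t → lookup x s + lookup x t ≢ c + q
        sum-off c f ne {s} {t} s<t eq with ρ s ≟ ρ t
        ... | no r≢ = f (ρ-live s) (ρ-live t) r≢ (trans (cong₂ _+_ (rep s) (rep t)) eq)
        ... | yes r with ρ-collide s<t r
        ...   | refl , refl = ne (trans (cong (λ z → lookup x i + z) (sym tied)) eq)

        off : ∀ {K} → Shi K → H ≢ K → ¬ x ∈[ q ] K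
        off (coord s) _ x∈ with congruent-near {a = lookup x s} {0} (x<q s)
                                  (<-≤-trans (>-nonZero⁻¹ q) (m≤n+m q _)) (∈-coord {x = x} {s = s} {0} x∈)
        ... | eq = <⇒≢ (<-≤-trans (s≤s z≤n) (2≤x s)) (sym eq)
        off (coord₁ s) _ x∈ with congruent-near {a = lookup x s} {1} (m<n⇒m<1+n (x<q s))
                                  (≤-trans (2≤x s) (m≤m+n _ q)) (∈-coord {x = x} {s = s} {1} x∈)
        ... | eq = <⇒≢ (2≤x s) (sym eq)
        off (plus l)  _ x∈ = sum-off 0 sum≢q (¬mid ∘ inj₁) l (sum-bound (s≤s z≤n) x∈)
        off (plus₁ l) _ x∈ = sum-off 1 sum≢1+q (¬mid ∘ inj₂) l (sum-bound (s≤s (s≤s z≤n)) x∈)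
        off (minus {s} {t} l) H≢K x∈ with congruent-near {a = lookup x s} {lookup x t}
                                            (<-≤-trans (x<q s) (m≤n+m q _)) (<-≤-trans (x<q t) (m≤n+m q _))
                                            (subst (λ z → q ∣ ∣ z ∣) (dot-minus {x = x} {q} s t 0) x∈)
        ... | eq with ρ s ≟ ρ t
        ...   | no r≢ = distinct (ρ-live s) (ρ-live t) r≢ (trans (rep s) (trans eq (sym (rep t))))
        ...   | yes r with ρ-collide l r
        ...     | refl , refl = H≢K refl
        -- Passing to representatives can only lower the index of `s`, while `hi` restores at least
        -- that of `t`; so the ascending order yields t < s, against s < t.
        off (minus₁ {s} {t} l) _ x∈ = <-asym l
            (≤-<-trans (t≤ t) (<-≤-trans (ascending (ρ-live s) (ρ-live t) eq) (≤s s)))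
          where
          eq : lookup x (ρ s) ≡ suc (lookup x (ρ t))
          eq = trans (rep s) (trans
            (congruent-near {a = lookup x s} {suc (lookup x t)} (<-≤-trans (x<q s) (m≤n+m q _))
              (<-≤-trans (s≤s (x<q t)) (+-monoˡ-≤ q (<⇒≤ (2≤x s))))
              (subst (λ z → q ∣ ∣ z ∣) (dot-minus {x = x} {q} s t 1) x∈))
            (cong suc (sym (rep t))))
          t≤ : ∀ t → toℕ t ≤ hi (ρ t)
          t≤ t with t ≟ j
          ... | yes refl = ≤-reflexive (sym hi-i)
          ... | no _     = ≤hi t
          ≤s : ∀ s → toℕ (ρ s) ≤ toℕ s
          ≤s s with s ≟ j
          ... | yes refl = <⇒≤ i<j
          ... | no _     = ≤-refl

      config⇒onlyOn : OnlyOn x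
      config⇒onlyOn = ∈-minus⁺ {x = x} {s = i} {j} 0 (sym tied) , All.tabulate λ K∈ →
        let (K∈′ , H≢K) = ∈-filter⁻ (λ K → ¬? (H ≟H K)) {xs = shiB m} K∈ in off (∈-shiB⁻ K∈′) H≢K

  Config-resp : ∀ {x x′} → (∀ s → x s ≡ x′ s) → Config x → Config x′
  Config-resp e X = record
    { 2≤x       = λ s → subst (2 ≤_) (e s) (2≤x s)
    ; x<q       = λ s → subst (_< q) (e s) (x<q s)
    ; tied      = trans (sym (e j)) (trans tied (e i))
    ; distinct  = λ s≢j t≢j s≢t → distinct s≢j t≢j s≢t ∘ subst₂ _≡_ (sym (e _)) (sym (e _))
    ; sum≢q     = λ s≢j t≢j s≢t → sum≢q s≢j t≢j s≢t ∘ trans (cong₂ _+_ (e _) (e _))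
    ; sum≢1+q   = λ s≢j t≢j s≢t → sum≢1+q s≢j t≢j s≢t ∘ trans (cong₂ _+_ (e _) (e _))
    ; ascending = λ s≢j t≢j → ascending s≢j t≢j ∘ subst₂ (λ k l → k ≡ suc l) (sym (e _)) (sym (e _))
    }
    where open Config X

  -- Enumeration of all choices and of the excluded ones

  module _ (α γ : List ℕ) (d : ℕ) where
    open Zones α (others b d) γ [ d ]

    zoneOf : Fin m → List ℕ
    zoneOf t = zone (toℕ i) (toℕ j) (toℕ t)

    -- `d` is the common value at `i` and `j`. Keeping `α` and `γ` open lets one product serve for
    -- all choices and for the excluded ones of either parity.
    zoneCart : List (Vec ℕ m)
    zoneCart = cart zoneOf

    zoneCart-unique : Unique α → Unique γ → Unique zoneCart
    zoneCart-unique uα uγ = cart-unique λ t → zone-elim i<j Unique (toℕ t)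
      (λ _ → uα) (λ _ _ → others-unique {b} {d}) (λ _ → uγ) (λ _ → [] ∷ [])

    module _ {y : Vec ℕ m} where

      ∈-zoneCart⁺ : Choice (lookup y) → lookup y i ≡ d →
        (∀ t → toℕ t < toℕ i → lookup y t ∈ α) → (∀ t → toℕ j < toℕ t → lookup y t ∈ γ) → y ∈ zoneCart
      ∈-zoneCart⁺ C refl hα hγ = ∈-cart⁺ λ t → zone-elim i<j (lookup y t ∈_) (toℕ t)
        (hα t)
        (λ i<t t<j → ∈-others⁺ (y<b t) (avoid i<t t<j))
        (hγ t)
        [ (λ e → here (cong (lookup y) (FinP.toℕ-injective e)))
        , (λ e → here (trans (cong (lookup y) (FinP.toℕ-injective e)) tied)) ]′
        where open Choice C

      module _ (y∈ : y ∈ zoneCart) where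
        private
          at : ∀ t {xs} → zoneOf t ≡ xs → lookup y t ∈ xs
          at t e = subst (lookup y t ∈_) e (∈-cart⁻ y∈ t)

          single : ∀ {v w : ℕ} → v ∈ [ w ] → v ≡ w
          single (here e) = e

        ∈-zoneCart-before : ∀ t → toℕ t < toℕ i → lookup y t ∈ α
        ∈-zoneCart-before t l = at t (zone-before {toℕ i} {toℕ j} l)

        ∈-zoneCart-after : ∀ t → toℕ j < toℕ t → lookup y t ∈ γ
        ∈-zoneCart-after t l = at t (zone-after {toℕ i} {toℕ j} i<j l)

        ∈-zoneCart-i : lookup y i ≡ d
        ∈-zoneCart-i = single (at i (zone-i (toℕ i) (toℕ j)))

        ∈-zoneCart-j : lookup y j ≡ d
        ∈-zoneCart-j = single (at j (zone-j i<j))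

        ∈-zoneCart⇒choice : d < b → (∀ {v} → v ∈ α → v < b) → (∀ {v} → v ∈ γ → v < b) → Choice (lookup y)
        ∈-zoneCart⇒choice d<b hα hγ = record
          { y<b   = λ t → zone-elim i<j (λ xs → lookup y t ∈ xs → lookup y t < b) (toℕ t)
              (λ _ → hα) (λ _ _ v∈ → proj₁ (∈-others⁻ v∈)) (λ _ → hγ) (λ _ v∈ → subst (_< b) (sym (single v∈)) d<b)
              (∈-cart⁻ y∈ t)
          ; tied  = trans ∈-zoneCart-j (sym ∈-zoneCart-i)
          ; avoid = λ {t} i<t t<j e → proj₂ (∈-others⁻ {b} {d} (at t (zone-between {toℕ i} {toℕ j} i<t t<j)))
              (trans e ∈-zoneCart-i)
          }

    length-zoneCart : d < b → ∀ {n n′} → length α ≡ n → length γ ≡ n′ →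
      length zoneCart ≡ n ^ toℕ i * (1 * (pred b ^ (toℕ j ∸ suc (toℕ i)) * (1 * n′ ^ (m ∸ suc (toℕ j)))))
    length-zoneCart d<b refl refl = trans
      (length-zone α (others b d) γ [ d ] m (toℕ i) (toℕ j) i<j (FinP.toℕ<n j))
      (cong (λ n → length α ^ toℕ i * (1 * (n ^ (toℕ j ∸ suc (toℕ i)) * (1 * length γ ^ (m ∸ suc (toℕ j))))))
            (cong pred (length-others d<b)))

  choices : List (Vec ℕ m)
  choices = concatMap (zoneCart (upTo b) (upTo b)) (upTo b)

  choices-unique : Unique choices
  choices-unique = concatMap-unique (Uniq.upTo⁺ b)
      (λ d → zoneCart-unique (upTo b) (upTo b) d (Uniq.upTo⁺ b) (Uniq.upTo⁺ b))
    λ y∈ y∈′ → trans (sym (∈-zoneCart-i _ _ _ y∈)) (∈-zoneCart-i _ _ _ y∈′)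

  ∈-choices⁺ : ∀ {y} → Choice (lookup y) → y ∈ choices
  ∈-choices⁺ C = ∈-concatMap⁺ (zoneCart (upTo b) (upTo b)) (lose (∈-upTo⁺ (y<b i))
    (∈-zoneCart⁺ _ _ _ C refl (λ t _ → ∈-upTo⁺ (y<b t)) (λ t _ → ∈-upTo⁺ (y<b t))))
    where open Choice C

  ∈-choices⁻ : ∀ {y} → y ∈ choices → Choice (lookup y)
  ∈-choices⁻ y∈ with find (∈-concatMap⁻ (zoneCart (upTo b) (upTo b)) {xs = upTo b} y∈)
  ... | d , d∈ , p = ∈-zoneCart⇒choice _ _ _ p (∈-upTo⁻ d∈) ∈-upTo⁻ ∈-upTo⁻

  place : Vec ℕ m → Vec ℕ m
  place y = tabulate (G (lookup y))

  lookup-place : ∀ y s → lookup (place y) s ≡ G (lookup y) s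
  lookup-place y = VecP.lookup∘tabulate (G (lookup y))

  place-injective : ∀ {y y′} → Choice (lookup y) → Choice (lookup y′) → place y ≡ place y′ → y ≡ y′
  place-injective {y} {y′} C C′ e = lookup-injective (G-injective C C′ λ s →
    trans (sym (lookup-place y s)) (trans (cong (λ x → lookup x s) e) (lookup-place y′ s)))

  place-i : ∀ y → lookup (place y) i ≡ position (lookup y) i
  place-i y = trans (lookup-place y i) (G-live (lookup y) i≢j)

  middle? : ∀ v → Dec (Middle v)
  middle? v = (v + v ℕ.≟ q) ⊎-dec (v + v ℕ.≟ suc q)

  onlyOn? : ∀ x → Dec (OnlyOn x)
  onlyOn? x = (x ∈[ q ]? H) ×-dec All.all? (λ K → ¬? (x ∈[ q ]? K)) (removeH H (shiB m))

  complement : List (Vec ℕ m)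
  complement = filter onlyOn? (points q m)

  ∈-complement⁻ : ∀ {x} → x ∈ complement → Config (lookup x) × ¬ Middle (lookup x i)
  ∈-complement⁻ {x} x∈ with ∈-filter⁻ onlyOn? {xs = points q m} x∈
  ... | x∈points , on = onlyOn⇒config (λ s → ∈-upTo⁻ (∈-cart⁻ (subst (x ∈_) (points≡cart q m) x∈points) s)) on

  ∈-complement⁺ : ∀ {x} → Config (lookup x) → ¬ Middle (lookup x i) → x ∈ complement
  ∈-complement⁺ {x} X ¬mid = ∈-filter⁺ onlyOn?
    (subst (x ∈_) (sym (points≡cart q m)) (∈-cart⁺ λ s → ∈-upTo⁺ (Config.x<q X s)))
    (config⇒onlyOn (Config.x<q X) X ¬mid)

  complement-unique : Unique complement
  complement-unique = Uniq.filter⁺ onlyOn? (subst Unique (sym (points≡cart q m))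
      (cart-unique {L = λ _ → upTo q} λ _ → Uniq.upTo⁺ q))

  module _ {S : List (Vec ℕ m)} (S-unique : Unique S)
           (∈S⁻ : ∀ y → y ∈ S → Choice (lookup y) × Middle (position (lookup y) i))
           (∈S⁺ : ∀ y → Choice (lookup y) → Middle (position (lookup y) i) → y ∈ S) where

    -- `S` lists the choices whose point violates 2x_i ∉ {0, 1}. Every choice is placed either in
    -- `complement` or in the image of `S`, and each configuration is the image of its own counts of
    -- empty residues.
    count-complement : countM m q H + length S ≡ length choices
    count-complement = begin
      length complement + length S             ≡⟨ cong (λ z → length complement + z) (length-map place S) ⟨
      length complement + length (map place S) ≡⟨ length-++ complement ⟨
      length (complement ++ map place S)       ≡⟨ length-unique left-unique right-unique to from ⟩
      length (map place choices)               ≡⟨ length-map place choices ⟩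
      length choices                           ∎
      where
      open ≡-Reasoning
      left-unique : Unique (complement ++ map place S)
      left-unique = Uniq.++⁺ complement-unique
        (map-unique (λ {y} {y′} y∈ y∈′ → place-injective {y} {y′} (proj₁ (∈S⁻ y y∈)) (proj₁ (∈S⁻ y′ y∈′))) S-unique)
        λ { {x} (x∈ , x∈′) → let (y , y∈ , x≡) = ∈-map⁻ place x∈′ in
            proj₂ (∈-complement⁻ x∈) (subst Middle (sym (trans (cong (λ z → lookup z i) x≡) (place-i y)))
                (proj₂ (∈S⁻ y y∈))) }
      right-unique : Unique (map place choices)
      right-unique = map-unique (λ {y} {y′} y∈ y∈′ → place-injective {y} {y′} (∈-choices⁻ y∈) (∈-choices⁻ y∈′))
          choices-unique
      to : ∀ {x} → x ∈ complement ++ map place S → x ∈ map place choices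
      to {x} x∈ with ∈-++⁻ complement x∈
      ... | inj₂ x∈S with ∈-map⁻ place x∈S
      ...   | y , y∈ , refl = ∈-map⁺ place (∈-choices⁺ {y} (proj₁ (∈S⁻ y y∈)))
      to {x} x∈ | inj₁ x∈c = subst (_∈ map place choices) back (∈-map⁺ place (∈-choices⁺ {tabulate y} choice))
        where
        open Empties (proj₁ (∈-complement⁻ x∈c))
        y≡ : ∀ s → lookup (tabulate y) s ≡ y s
        y≡ = VecP.lookup∘tabulate y
        choice : Choice (lookup (tabulate y))
        choice = record
          { y<b   = λ s → subst (_< b) (sym (y≡ s)) (Choice.y<b y-choice s)
          ; tied  = trans (y≡ j) (trans (Choice.tied y-choice) (sym (y≡ i)))
          ; avoid = λ {t} i<t t<j e → Choice.avoid y-choice i<t t<j (trans (sym (y≡ t)) (trans e (y≡ i)))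
          }
        back : place (tabulate y) ≡ x
        back = lookup-injective λ s → trans (lookup-place (tabulate y) s) (trans (G-resp y≡ s) (G-y s))
      from : ∀ {x} → x ∈ map place choices → x ∈ complement ++ map place S
      from x∈ with ∈-map⁻ place x∈
      ... | y , y∈ , refl with middle? (position (lookup y) i)
      ...   | yes mid = ∈-++⁺ʳ complement (∈-map⁺ place (∈S⁺ y (∈-choices⁻ y∈) mid))
      ...   | no ¬mid = ∈-++⁺ˡ (∈-complement⁺
                (Config-resp (sym ∘ lookup-place y) (G-config {lookup y} (∈-choices⁻ y∈)))
                (λ mid → ¬mid (subst Middle (place-i y) mid)))

  between after : ℕ
  between = toℕ j ∸ suc (toℕ i)
  after   = m ∸ suc (toℕ j)

  length-choices : length choices ≡ b * (b ^ toℕ i * (1 * (pred b ^ between * (1 * b ^ after))))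
  length-choices = trans
    (length-concatMap (zoneCart (upTo b) (upTo b)) (upTo b)
      λ {d} d∈ → length-zoneCart (upTo b) (upTo b) d (∈-upTo⁻ d∈) (length-upTo b) (length-upTo b))
    (cong (_* (b ^ toℕ i * (1 * (pred b ^ between * (1 * b ^ after))))) (length-upTo b))

  -- For odd `q` only 2x_i = q + 1 can occur, which forces y_i = d; the ban on ties with smaller
  -- indices removes one value from each factor before `i`.
  count-odd : ∀ {d} → suc (d + d) ≡ b → (∀ v → v + v ≢ q) →
    countM m q H + pred b ^ toℕ i * (1 * (pred b ^ between * (1 * b ^ after))) ≡ length choices
  count-odd {d} eb no-half = trans (cong (λ z → countM m q H + z)
      (sym (length-zoneCart (others b d) (upTo b) d d<b (cong pred (length-others d<b)) (length-upTo b))))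
    (count-complement (zoneCart-unique (others b d) (upTo b) d (others-unique {b} {d}) (Uniq.upTo⁺ b)) to from)
    where
    d<b : d < b
    d<b = ≤-trans (s≤s (m≤m+n d d)) (≤-reflexive eb)
    S = zoneCart (others b d) (upTo b) d
    to : ∀ y → y ∈ S → Choice (lookup y) × Middle (position (lookup y) i)
    to y y∈ = ∈-zoneCart⇒choice _ _ _ y∈ d<b (λ v∈ → proj₁ (∈-others⁻ v∈)) ∈-upTo⁻ ,
      inj₂ (middle-odd⁺ (lookup y) i≢j (trans (cong (λ v → suc (v + v)) yi≡d) eb)
        λ u _ u<i e → proj₂ (∈-others⁻ {b} {d} (∈-zoneCart-before _ _ _ y∈ u u<i)) (trans e yi≡d))
      where
      yi≡d : lookup y i ≡ d
      yi≡d = ∈-zoneCart-i _ _ _ y∈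
    from : ∀ y → Choice (lookup y) → Middle (position (lookup y) i) → y ∈ S
    from y C (inj₁ e) = contradiction e (no-half (position (lookup y) i))
    from y C (inj₂ e) with middle-odd⁻ (lookup y) i≢j e
    ... | ey , f = ∈-zoneCart⁺ _ _ _ C yi≡d
      (λ t t<i → ∈-others⁺ (Choice.y<b C t) λ e → f t (λ { refl → <-asym t<i i<j }) t<i (trans e (sym yi≡d)))
      (λ t _ → ∈-upTo⁺ (Choice.y<b C t))
      where
      yi≡d : lookup y i ≡ d
      yi≡d = double-injective (suc-injective (trans ey (sym eb)))

  -- For even `q` only 2x_i = q can occur. The ban on ties now concerns larger indices; between `i`
  -- and `j` it is already part of `Choice`, so only the factors after `j` shrink.
  count-even : ∀ {d} → suc (suc (d + d)) ≡ b → (∀ v → v + v ≢ suc q) →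
    countM m q H + b ^ toℕ i * (1 * (pred b ^ between * (1 * pred b ^ after))) ≡ length choices
  count-even {d} eb no-half = trans (cong (λ z → countM m q H + z)
      (sym (length-zoneCart (upTo b) (others b d) d d<b (length-upTo b) (cong pred (length-others d<b)))))
    (count-complement (zoneCart-unique (upTo b) (others b d) d (Uniq.upTo⁺ b) (others-unique {b} {d})) to from)
    where
    d<b : d < b
    d<b = ≤-trans (s≤s (≤-trans (m≤m+n d d) (n≤1+n _))) (≤-reflexive eb)
    S = zoneCart (upTo b) (others b d) d
    to : ∀ y → y ∈ S → Choice (lookup y) × Middle (position (lookup y) i)
    to y y∈ = C , inj₁ (middle-even⁺ (lookup y) i≢j (trans (cong (λ v → suc (suc (v + v))) yi≡d) eb) f)
      where
      C = ∈-zoneCart⇒choice _ _ _ y∈ d<b ∈-upTo⁻ (λ v∈ → proj₁ (∈-others⁻ v∈))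
      yi≡d : lookup y i ≡ d
      yi≡d = ∈-zoneCart-i _ _ _ y∈
      f : ∀ u → u ≢ j → toℕ i < toℕ u → lookup y u ≢ lookup y i
      f u u≢j i<u e with toℕ u <? toℕ j
      ... | yes u<j = Choice.avoid C i<u u<j e
      ... | no u≮j = proj₂ (∈-others⁻ {b} {d} (∈-zoneCart-after _ _ _ y∈ u
          (≤∧≢⇒< (≮⇒≥ u≮j) (u≢j ∘ sym ∘ FinP.toℕ-injective)))) (trans e yi≡d)
    from : ∀ y → Choice (lookup y) → Middle (position (lookup y) i) → y ∈ S
    from y C (inj₂ e) = contradiction e (no-half (position (lookup y) i))
    from y C (inj₁ e) with middle-even⁻ (lookup y) i≢j e
    ... | ey , f = ∈-zoneCart⁺ _ _ _ C yi≡d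
      (λ t _ → ∈-upTo⁺ (Choice.y<b C t))
      (λ t j<t → ∈-others⁺ (Choice.y<b C t) λ e → f t (λ { refl → <-irrefl refl j<t }) (<-trans i<j j<t)
          (trans e (sym yi≡d)))
      where
      yi≡d : lookup y i ≡ d
      yi≡d = double-injective (suc-injective (suc-injective (trans ey (sym eb))))

-- The formula in the integers

pos-^ : ∀ n k → (+ n) ℤ.^ k ≡ + (n ^ k)
pos-^ n zero    = refl
pos-^ n (suc k) = trans (cong (+ n ℤ.*_) (pos-^ n k)) (sym (ℤP.pos-* n (n ^ k)))

pos-difference : ∀ {c p s t} → c + p * t ≡ p * s → + c ≡ + p ℤ.* (+ s ℤ.- + t)
pos-difference {c} {p} {s} {t} e = begin
  + c                                       ≡⟨ ℤP.+-identityʳ (+ c) ⟨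
  + c ℤ.+ + 0                               ≡⟨ cong (λ z → + c ℤ.+ z) (ℤP.+-inverseʳ (+ (p * t))) ⟨
  + c ℤ.+ (+ (p * t) ℤ.- + (p * t))         ≡⟨ ℤP.+-assoc (+ c) (+ (p * t)) (ℤ.- + (p * t)) ⟨
  + (c + p * t) ℤ.- + (p * t)               ≡⟨ cong (λ z → + z ℤ.- + (p * t)) e ⟩
  + (p * s) ℤ.- + (p * t)                   ≡⟨ cong₂ ℤ._-_ (ℤP.pos-* p s) (ℤP.pos-* p t) ⟩
  + p ℤ.* + s ℤ.- + p ℤ.* + t               ≡⟨ cong (λ z → + p ℤ.* + s ℤ.+ z) (ℤP.neg-distribʳ-* (+ p) (+ t)) ⟩
  + p ℤ.* + s ℤ.+ + p ℤ.* (ℤ.- + t)         ≡⟨ ℤP.*-distribˡ-+ (+ p) (+ s) (ℤ.- + t) ⟨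
  + p ℤ.* (+ s ℤ.- + t)                     ∎
  where open ≡-Reasoning

module _ (α β : ℕ) where

  pos-formula : ∀ {c} k₁ k₂ k₃ k₄ {x y} → c + α ^ k₁ * β ^ k₂ * y ^ k₄ ≡ α ^ k₁ * β ^ k₂ * x ^ k₃ →
    + c ≡ (+ α) ℤ.^ k₁ ℤ.* (+ β) ℤ.^ k₂ ℤ.* ((+ x) ℤ.^ k₃ ℤ.- (+ y) ℤ.^ k₄)
  pos-formula k₁ k₂ k₃ k₄ {x} {y} e
    rewrite pos-^ α k₁ | pos-^ β k₂ | pos-^ x k₃ | pos-^ y k₄ | sym (ℤP.pos-* (α ^ k₁) (β ^ k₂)) =
    pos-difference {p = α ^ k₁ * β ^ k₂} {x ^ k₃} {y ^ k₄} e
-- Writing q = r + 2m turns both bases into natural numbers, and `r` has the parity of `q`. The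
-- middle value is therefore r / 2 + 1 for odd `q`, from 2d + 1 = r + 2, and r / 2 for even `q`,
-- from 2d + 2 = r + 2.
module Shifted (m : ℕ) (i j : Fin m) (i<j : toℕ i < toℕ j) (r : ℕ) where
  q a b : ℕ
  q = r + 2 * m
  a = suc r
  b = suc (suc r)

  0<m : 0 < m
  0<m = ≤-<-trans z≤n (FinP.toℕ<n i)

  instance
    q-nonZero : NonZero q
    q-nonZero = >-nonZero (≤-trans 0<m (≤-trans (m≤m+n m (m + 0)) (m≤n+m (2 * m) r)))

  q≡ : q + 2 ≡ b + m * 2
  q≡ = arith r m
    where
    arith : ∀ r m → r + 2 * m + 2 ≡ suc (suc r) + m * 2
    arith = solve-∀

  open Restriction m i j i<j q b q≡

  not-double : ∀ {n} → n % 2 ≡ 1 → ∀ v → v + v ≢ n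
  not-double odd v refl = 0≢1+n (trans (sym (m*n%n≡0 v 2)) (trans (cong (_% 2) (*2≡+ v)) odd))

  r%2 : r % 2 ≡ q % 2
  r%2 = trans (sym ([m+kn]%n≡m%n r m 2)) (cong (λ k → (r + k) % 2) (*-comm m 2))

  r≡ : r ≡ q % 2 + (r / 2 + r / 2)
  r≡ = trans (m≡m%n+[m/n]*n r 2) (cong₂ _+_ r%2 (*2≡+ (r / 2)))

  odd-case : q % 2 ≡ 1 → + countM m q H ≡
    (+ a) ℤ.^ between ℤ.* (+ b) ℤ.^ after ℤ.* ((+ b) ℤ.^ suc (toℕ i) ℤ.- (+ a) ℤ.^ toℕ i)
  odd-case odd = pos-formula a b between after (suc (toℕ i)) (toℕ i)
    (trans (cong (λ z → countM m q H + z) (sym (arith₁ (a ^ toℕ i) (a ^ between) (b ^ after))))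
    (trans (count-odd {suc (r / 2)} eb (not-double odd))
        (trans length-choices (arith₂ b (b ^ toℕ i) (a ^ between) (b ^ after)))))
    where
    eb : suc (suc (r / 2) + suc (r / 2)) ≡ b
    eb = cong suc (trans (cong suc (+-suc (r / 2) (r / 2)))
        (cong suc (trans (cong (_+ (r / 2 + r / 2)) (sym odd)) (sym r≡))))
    arith₁ : ∀ x y z → x * (1 * (y * (1 * z))) ≡ y * z * x
    arith₁ = solve-∀
    arith₂ : ∀ b x y z → b * (x * (1 * (y * (1 * z)))) ≡ y * z * (b * x)
    arith₂ = solve-∀

  even-case : q % 2 ≡ 0 → + countM m q H ≡
    (+ a) ℤ.^ between ℤ.* (+ b) ℤ.^ toℕ i ℤ.* ((+ b) ℤ.^ (after + 1) ℤ.- (+ a) ℤ.^ after)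
  even-case even = pos-formula a b between (toℕ i) (after + 1) after
    (trans (cong (λ z → countM m q H + z) (sym (arith₁ (b ^ toℕ i) (a ^ between) (a ^ after))))
    (trans (count-even {r / 2} eb (not-double odd′)) (trans length-choices
      (trans (arith₂ b (b ^ toℕ i) (a ^ between) (b ^ after))
          (cong (λ k → a ^ between * b ^ toℕ i * b ^ k) (+-comm 1 after))))))
    where
    eb : suc (suc (r / 2 + r / 2)) ≡ b
    eb = cong (λ n → suc (suc n)) (trans (cong (_+ (r / 2 + r / 2)) (sym even)) (sym r≡))
    odd′ : suc q % 2 ≡ 1
    odd′ = trans (cong (λ n → suc n % 2) (m≡m%n+[m/n]*n q 2))
        (trans (cong (λ k → suc (k + q / 2 * 2) % 2) even) ([m+kn]%n≡m%n 1 (q / 2) 2))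
    arith₁ : ∀ x y z → x * (1 * (y * (1 * z))) ≡ y * x * z
    arith₁ = solve-∀
    arith₂ : ∀ b x y z → b * (x * (1 * (y * (1 * z)))) ≡ y * x * (b * z)
    arith₂ = solve-∀

theorem5p1 : (m : ℕ) (i j : Fin m) → toℕ i < toℕ j →
  ∃[ Q ] ∀ (q : ℕ) → 1 ≤ q → Q ≤ q →
    let I = suc (toℕ i)
        J = suc (toℕ j)
        a = + q ℤ.- + (2 ℕ.* m) ℤ.+ + 1
        b = + q ℤ.- + (2 ℕ.* m) ℤ.+ + 2
        H = (e i ⊖ e j , + 0)
    in (q % 2 ≡ 1 → + countM m q H ≡ a ℤ.^ (J ∸ I ∸ 1) ℤ.* b ℤ.^ (m ∸ J) ℤ.* (b ℤ.^ I ℤ.- a ℤ.^ (I ∸ 1)))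
     × (q % 2 ≡ 0 → + countM m q H ≡ a ℤ.^ (J ∸ I ∸ 1) ℤ.* b ℤ.^ (I ∸ 1) ℤ.*
         (b ℤ.^ (m ∸ J ℕ.+ 1) ℤ.- a ℤ.^ (m ∸ J)))
-- From the threshold 2m on, q - 2m is a natural number, as `Shifted` requires.
theorem5p1 m i j i<j = 2 ℕ.* m , λ q _ 2m≤q → shifted {q} {q ∸ 2 ℕ.* m} (m∸n+n≡m 2m≤q)
  where
  H = (e i ⊖ e j , + 0)

  exponent : toℕ j ∸ toℕ i ∸ 1 ≡ toℕ j ∸ suc (toℕ i)
  exponent = trans (∸-+-assoc (toℕ j) (toℕ i) 1) (cong (toℕ j ∸_) (+-comm (toℕ i) 1))

  shift : ∀ r k → + (r ℕ.+ 2 ℕ.* m) ℤ.- + (2 ℕ.* m) ℤ.+ + k ≡ + (k ℕ.+ r)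
  shift r k = trans (cong (ℤ._+ + k) (trans (ℤP.+-assoc (+ r) (+ (2 ℕ.* m)) (ℤ.- + (2 ℕ.* m)))
      (trans (cong (λ z → + r ℤ.+ z) (ℤP.+-inverseʳ (+ (2 ℕ.* m)))) (ℤP.+-identityʳ (+ r)))))
                    (cong +_ (+-comm r k))

  shifted : ∀ {q r} → r ℕ.+ 2 ℕ.* m ≡ q →
    let a = + q ℤ.- + (2 ℕ.* m) ℤ.+ + 1
        b = + q ℤ.- + (2 ℕ.* m) ℤ.+ + 2
    in (q % 2 ≡ 1 → + countM m q H ≡ a ℤ.^ (toℕ j ∸ toℕ i ∸ 1) ℤ.* b ℤ.^ (m ∸ suc (toℕ j)) ℤ.*
        (b ℤ.^ suc (toℕ i) ℤ.- a ℤ.^ toℕ i))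
     × (q % 2 ≡ 0 → + countM m q H ≡ a ℤ.^ (toℕ j ∸ toℕ i ∸ 1) ℤ.* b ℤ.^ toℕ i ℤ.*
         (b ℤ.^ (m ∸ suc (toℕ j) ℕ.+ 1) ℤ.- a ℤ.^ (m ∸ suc (toℕ j))))
  shifted {r = r} refl rewrite shift r 1 | shift r 2 | exponent = Shifted.odd-case m i j i<j r ,
      Shifted.even-case m i j i<j r
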